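{- Let $n\ge0$ and let $\sigma,\tau\in\mathrm{Typ}(n)$ be types of $n$. The coefficient of $E^+_\tau$ in the expansion of $E_\sigma$ in the basis $\{E^+_\rho:\rho\in\mathrm{Typ}(n)\}$ is $$(-1)^{\ell(\tau)}\,|\mathcal{PT}^{\mathrm{dyad}}(\sigma, \tau)|.$$
   Context: A type of $n$ is a sequence $\tau=(\tau|^1,\tau|^2,\dots)$ of (possibly empty) integer partitions with $\sum_{i\ge1} i\,|\tau|^i|=n$, where $|\tau|^i|$ is the size of the partition $\tau|^i$; $\mathrm{Typ}(n)$ is the set of types of $n$. Its length is $\ell(\tau)=\sum_i\ell(\tau|^i)$. Each part $d$ of $\tau|^r$ gives a block $d^r$ of $\tau$ (degree $d$, multiplicity $r$; not exponentiation); a type is thus a multiset of blocks. Let $x_{i,j}$ ($i,j\ge 1$) be indeterminates with $\deg x_{i,j}=i$; all series have rational coefficients. A monomial is square-free if every exponent is at most $1$. $E^+_d$ is the sum of all square-free monomials of degree $d$; $E_d$ is the sum over square-free monomials $f$ of degree $d$ of $(-1)^{m(f)}f$, where $m(f)$ is the number of indeterminates in $f$. For $F\in\{E,E^+\}$, $F_{d^r}$ is obtained from $F_d$ by replacing each $x_{i,j}$ by $x_{i,j}^r$, and $F_\tau=\prod F_{d^r}$ over all blocks $d^r$ of $\tau$ (counted with repetition; empty product $=1$). It is known that $\{F_\tau\}_{\tau\in\mathrm{Typ}(n)}$ is, for each such $F$, a $\mathbb{Q}$-basis of the space $\mathrm{PSym}(n)$ of polysymmetric functions of degree $n$ (power series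 homogeneous of degree $n$ that are symmetric separately in each variable set $\{x_{i,j}\}_{j\ge1}$). The diagram of a partition $\lambda$ has left-justified rows of $\lambda_1,\lambda_2,\dots$ cells; the tensor diagram of $\sigma$ is the sequence of diagrams of $\sigma|^1,\sigma|^2,\dots$, the $i$th one being called the $i$th tensor factor. A brick is a nonempty set of consecutive cells in one row; its length is its number of cells. For $k\ge0$, a $k$-brick is a brick whose length is a multiple of $2^k$, carrying the marking $k$. A dyadic polybrick tabloid of shape $\sigma$ and content $\tau$ is a decomposition of the tensor diagram of $\sigma$ into disjoint $k$-bricks (for various $k\ge0$, the markings being part of the data) such that, in each row, whenever $k'>k$ every $k'$-brick appears to the right of every $k$-brick, and such that $\tau$ is the multiset of blocks obtained by taking a block $b^{2^k m}$ for each $k$-brick of length $2^k b$ in the $m$th tensor factor. $\mathcal{PT}^{\mathrm{dyad}}(\sigma,\tau)$ is the set of these. -}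

module Defs where

open import Algebra.Definitions.RawSemiring using ()
open import Data.Bool using (Bool; if_then_else_)
open import Data.List using (List; []; _∷_; _++_; map; concat; cartesianProductWith; filter; foldr; length; upTo)
open import Data.List.Membership.Propositional using (_∉_)
open import Data.List.Relation.Binary.Permutation.Propositional using (_↭_)
open import Data.List.Relation.Unary.All as All using (All; []; _∷_; all?)
open import Data.List.Relation.Unary.AllPairs using (AllPairs)
open import Data.List.Relation.Unary.Linked using (Linked)
open import Data.List.Relation.Unary.Unique.Propositional using (Unique)
open import Data.Nat using (ℕ; zero; suc; _+_; _*_; _∸_; _^_; _/_; _≤_; _≥_; _≟_; _≤?_; NonZero)
open import Data.Nat.Divisibility using (_∣?_)
open import Data.Nat.ListAction using (sum)
open import Data.Nat.Properties using (m*n≢0; m^n≢0)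
open import Data.Product using (_×_; _,_; ∃-syntax)
open import Data.Rational as ℚ using (ℚ; 0ℚ; 1ℚ)
open import Data.Vec as Vec using (Vec; []; _∷_)
open import Data.Vec.Relation.Unary.All as VecAll using ([]; _∷_)
open import Function using (_∘_; _on_)
open import Relation.Binary.PropositionalEquality using (_≡_)
open import Relation.Nullary using (does)
open import Relation.Nullary.Decidable using (_×-dec_)

-- Laws are stored in irrelevant fields throughout, so that propositional
-- equality of partitions, types and tabloids is equality of their data.

record Partition : Set where
  constructor mkPartition
  field
    parts       : List ℕ
    .positive   : All NonZero parts
    .decreasing : Linked _≥_ parts

  size : ℕ
  size = sum parts

open Partition public

-- In every function …From i the head of the argument has index suc i, so that
-- the indices 1, 2, … of the entries are obtained from the offset 0.
weightFrom : ∀ {k} → ℕ → Vec Partition k → ℕ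
weightFrom i []       = 0
weightFrom i (p ∷ ps) = suc i * size p + weightFrom (suc i) ps

-- In a type of n the partitions τ|ⁱ with i > n are forced to be empty, so
-- only τ|¹, …, τ|ⁿ are recorded.
record Typ (n : ℕ) : Set where
  constructor mkTyp
  field
    factors : Vec Partition n
    .weight : weightFrom 0 factors ≡ n

open Typ public

ℓ : ∀ {n} → Typ n → ℕ
ℓ τ = Vec.sum (Vec.map (length ∘ parts) (factors τ))

record Block : Set where
  constructor block
  field
    degree       : ℕ
    multiplicity : ℕ
    .{{mult≢0}}  : NonZero multiplicity

blocksFrom : ∀ {k} → ℕ → Vec Partition k → List Block
blocksFrom i []       = []
blocksFrom i (p ∷ ps) = map (λ d → block d (suc i)) (parts p) ++ blocksFrom (suc i) ps

blocks : ∀ {n} → Typ n → List Block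
blocks τ = blocksFrom 0 (factors τ)

-- The j-th entry of the i-th row (both counted from 1) is the exponent of the
-- indeterminate x i j, which has degree i; missing entries are 0.
-- Trailing zeros make this representation non-unique; every series below
-- gives all representatives of a monomial the same coefficient.
Monomial : Set
Monomial = List (List ℕ)

degreeFrom : ℕ → Monomial → ℕ
degreeFrom i []       = 0
degreeFrom i (r ∷ rs) = suc i * sum r + degreeFrom (suc i) rs

deg : Monomial → ℕ
deg = degreeFrom 0

numVars : Monomial → ℕ
numVars m = length (filter (1 ≤?_) (concat m))

Series : Set
Series = Monomial → ℚ

infix 4 _≈_
_≈_ : Series → Series → Set
F ≈ G = ∀ m → F m ≡ G m

∑ : {A : Set} → List A → (A → ℚ) → ℚ
∑ xs f = foldr (λ x s → f x ℚ.+ s) 0ℚ xs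

-- All factorisations of an object into two, for exponents, rows of
-- exponents and monomials.  Keeping the shape of the input fixed means that
-- every factorisation is listed exactly once.
splitℕ : ℕ → List (ℕ × ℕ)
splitℕ e = map (λ a → a , e ∸ a) (upTo (suc e))

splitList : {A : Set} → (A → List (A × A)) → List A → List (List A × List A)
splitList split []       = ([] , []) ∷ []
splitList split (x ∷ xs) =
  cartesianProductWith (λ (a , b) (as , bs) → a ∷ as , b ∷ bs)
    (split x) (splitList split xs)

factorisations : Monomial → List (Monomial × Monomial)
factorisations = splitList (splitList splitℕ)

infixl 7 _·_
_·_ : Series → Series → Series
(F · G) m = ∑ (factorisations m) λ (a , b) → F a ℚ.* G b

one : Series
one m = if does (all? (all? (_≟ 0)) m) then 1ℚ else 0ℚ

-- The substitution x i j ↦ (x i j) ^ r: only monomials m′ ^ r survive, with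
-- the coefficient of m′.
substPower : (r : ℕ) .{{_ : NonZero r}} → Series → Series
substPower r F m =
  if does (all? (all? (r ∣?_)) m) then F (map (map (_/ r)) m) else 0ℚ

sign : ℕ → ℚ
sign k = (ℚ.- 1ℚ) ^ℚ k
  where open Algebra.Definitions.RawSemiring ℚ.+-*-rawSemiring renaming (_^_ to _^ℚ_)

isSquareFreeOfDegree : ℕ → Monomial → Bool
isSquareFreeOfDegree d m = does (all? (all? (_≤? 1)) m ×-dec (deg m ≟ d))

E⁺-deg : ℕ → Series
E⁺-deg d m = if isSquareFreeOfDegree d m then 1ℚ else 0ℚ

E-deg : ℕ → Series
E-deg d m = if isSquareFreeOfDegree d m then sign (numVars m) else 0ℚ

atBlock : (ℕ → Series) → Block → Series
atBlock F (block d r) = substPower r (F d)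

atType : (ℕ → Series) → ∀ {n} → Typ n → Series
atType F τ = foldr (λ b G → atBlock F b · G) one (blocks τ)

E⁺ : ∀ {n} → Typ n → Series
E⁺ = atType E⁺-deg

E : ∀ {n} → Typ n → Series
E = atType E-deg

record IsExpansion {I : Set} (b : I → Series) (F : Series) (c : I → ℚ) : Set where
  field
    support   : List I
    distinct  : Unique support
    vanishing : ∀ i → i ∉ support → c i ≡ 0ℚ
    expands   : F ≈ λ m → ∑ support λ i → c i ℚ.* b i m

-- F has exactly one expansion in the family b, and q is its coefficient
-- at i.
IsCoefficient : {I : Set} → (I → Series) → Series → I → ℚ → Set
IsCoefficient b F i q =
  ∃[ c ] IsExpansion b F c
       × (∀ c′ → IsExpansion b F c′ → ∀ j → c′ j ≡ c j)
       × c i ≡ q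

-- A k-brick of length 2 ^ k * b, where k is the marking.
record Brick : Set where
  constructor brick
  field
    marking       : ℕ
    quotient      : ℕ
    .{{nonempty}} : NonZero quotient

  brickLength : ℕ
  brickLength = 2 ^ marking * quotient

open Brick public using (marking; brickLength)

-- A decomposition of a row of L cells into bricks, which are listed from left
-- to right; their positions are determined by their lengths.
record RowTiling (L : ℕ) : Set where
  constructor mkRowTiling
  field
    bricks   : List Brick
    .ordered : AllPairs (_≤_ on marking) bricks
    .fills   : sum (map brickLength bricks) ≡ L

open RowTiling public using (bricks)

FactorTiling : Partition → Set
FactorTiling p = All RowTiling (parts p)

-- The block of a brick in the tensor factor with index suc i.
brickBlock : ℕ → Brick → Block
brickBlock i (brick k b) = block b (2 ^ k * suc i)
  {{m*n≢0 (2 ^ k) (suc i) {{m^n≢0 2 k}}}}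

factorContent : ℕ → ∀ {rows} → All RowTiling rows → List Block
factorContent i = concat ∘ All.reduce (map (brickBlock i) ∘ bricks)

contentFrom : ∀ {k} → ℕ → {ps : Vec Partition k} → VecAll.All FactorTiling ps → List Block
contentFrom i []       = []
contentFrom i (t ∷ ts) = factorContent i t ++ contentFrom (suc i) ts

record PTdyad {n : ℕ} (σ τ : Typ n) : Set where
  constructor mkPTdyad
  field
    tilings  : VecAll.All FactorTiling (factors σ)
    .content : contentFrom 0 tilings ↭ blocks τ

module Submission where

-- Since 1 - x = ∏ₖ 1 / (1 + x ^ 2ᵏ), the generating series of the E_d is the product over k of the
-- inverses of the generating series of the E⁺_d with all indeterminates raised to the power 2ᵏ.
-- Expanding the k-th inverse as a geometric series gives the signed sum over all sequences of
-- k-bricks, so that E_d is the signed sum over all tilings of a row of d cells, and multiplying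
-- over the rows of σ gives the expansion of E_σ.
--
-- For the uniqueness of the coefficients, the blocks of σ are read as a monomial with one
-- indeterminate of degree d and exponent r for every block d^r.  It occurs in E⁺_σ with a positive
-- coefficient, and in no other E⁺_τ unless ∑ (d² r + 1), summed over blocks, is larger for τ than for σ.

open import Defs
open import Algebra.Bundles using (CommutativeRing; module CommutativeMonoid)
import Algebra.Properties.CommutativeSemigroup as CommutativeSemigroupProperties
open import Algebra.Structures using (IsCommutativeRing)
open import Data.Bool using (Bool; true; false; if_then_else_; _∧_)
open import Data.Empty using (⊥)
open import Data.Fin using (Fin; zero; suc)
open import Data.Integer as ℤ using (+_)
import Data.Integer.Properties as ℤ
open import Data.List using (List; []; _∷_; _++_; map; filter; foldr; length; lookup; concat; deduplicate; applyUpTo; cartesianProductWith)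
open import Data.List.Membership.DecPropositional using (_∈?_)
open import Data.List.Membership.Propositional using (_∈_; _∉_; mapWith∈)
open import Data.List.Membership.Propositional.Properties using (∈-map⁺; ∈-map⁻; ∈-++⁺ˡ; ∈-++⁺ʳ; ∈-++⁻; ∈-concat⁺′; ∈-concat⁻′; ∈-cartesianProductWith⁺; ∈-cartesianProductWith⁻; ∈-upTo⁺; ∈-upTo⁻; ∈-filter⁺; ∈-filter⁻; ∈-deduplicate⁺; ∈-lookup; map-mapWith∈; mapWith∈-id)
open import Data.List.Properties as List using (map-applyUpTo; map-++; map-∘; map-id; filter-++; filter-all; filter-none; length-++; length-map; ++-identityʳ)
open import Data.List.Relation.Binary.Equality.Propositional using (≋⇒≡)
open import Data.List.Relation.Binary.Permutation.Propositional as Perm using (_↭_; ↭-refl; ↭-sym; ↭-trans; ↭-reflexive; ↭-prep; ↭⇒↭ₛ)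
open import Data.List.Relation.Binary.Permutation.Propositional.Properties as Perm using (All-resp-↭; ∈-resp-↭; filter-↭; ↭-length; ↭-empty-inv; drop-∷)
open import Data.List.Relation.Unary.All as All using (All; []; _∷_; all?)
import Data.List.Relation.Unary.All.Properties as All
open import Data.List.Relation.Unary.AllPairs as AllPairs using (AllPairs; []; _∷_)
import Data.List.Relation.Unary.AllPairs.Properties as AllPairs
open import Data.List.Relation.Unary.Any using (here; there; index)
open import Data.List.Relation.Unary.Any.Properties using (lookup-index)
open import Data.List.Relation.Unary.Linked using (Linked; linked?)
import Data.List.Relation.Unary.Sorted.TotalOrder.Properties as Sorted
open import Data.List.Relation.Unary.Unique.DecPropositional.Properties using (deduplicate-!)
open import Data.List.Relation.Unary.Unique.Propositional using (Unique)
import Data.List.Relation.Unary.Unique.Propositional.Properties as Unique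
import Data.List.Sort as Sort
import Data.Nat.Coprimality as Coprimality
open import Data.Nat as ℕ using (ℕ; zero; suc; _^_; NonZero)
open import Data.Nat.DivMod using (m/n*n≡m; m*n/n≡m)
open import Data.Nat.Divisibility using (_∣_; _∣?_; _∣0; ∣-refl; ∣m∣n⇒∣m+n; ∣n⇒∣m*n; divides)
open import Data.Nat.ListAction using (sum)
open import Data.Nat.ListAction.Properties using (sum-++; sum-↭)
import Data.Nat.Properties as ℕ
open import Data.Nat.Tactic.RingSolver using (solve-∀)
open import Data.Product using (_×_; _,_; proj₁; proj₂; map₁; ∃-syntax)
open import Data.Rational as ℚ using (ℚ; 0ℚ; 1ℚ; _*_; _/_; NonNegative; Positive)
import Data.Rational.Properties as ℚ
open import Data.Sum using (_⊎_; inj₁; inj₂)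
open import Data.Unit using (⊤; tt)
open import Data.Vec as Vec using (Vec; []; _∷_)
import Data.Vec.Properties as Vec
open import Data.Vec.Relation.Unary.All as VecAll using ([]; _∷_)
open import Function using (_∘_; _on_; id)
open import Function.Bundles using (_↔_; mk↔ₛ′; mk⇔)
open import Relation.Binary.Bundles using (DecTotalOrder)
import Relation.Binary.Construct.Flip.EqAndOrd as Flip
open import Relation.Binary.Definitions using (DecidableEquality)
open import Relation.Binary.PropositionalEquality
open import Relation.Nullary using (Dec; does; yes; no; ¬_; contradiction; recompute)
open import Relation.Nullary.Decidable using (dec-true; dec-false; does-⇔; map′; ¬?)
open import Relation.Unary using (Decidable)
open Block using (degree; multiplicity)
open ≡-Reasoning

-- Neither the infinite product nor an inverse is ever formed. All rests on (1 + x^r)(1 - x^r) = 1 -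
-- x^(2r). Read degree by degree, it expresses E at the block d^r through E at smaller degrees and
-- the same multiplicity, plus the degree d r part of the product of all 1 - x^(2r). That part is
-- again an E, of degree d/2 and multiplicity 2r, and it is zero for odd d. This is why brick
-- lengths are multiples of 2^k and why larger markings stand further right: the finest bricks are
-- split off first.
--
-- Coefficients live on exponent lists of arbitrary shape. Each series is therefore written as a
-- test of the degree times a product of one-variable weights, so that identities need checking in
-- one variable only.
--
-- The rank has to grow in two moves: when an exponent is divided between two factors, and when
-- variables of equal exponent are merged into one block of their total degree. The first turns one
-- block into two, which the summand 1 rewards. The second turns two blocks into one, and the square
-- is there because its cross term 2 d e r outweighs that loss.

private variable
  A B C : Set

-- Opaque copies of the operations of ℚ: the originals unfold to fractions,
-- which keeps the unifier from inferring the summands of a sum.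
infixl 6 _⊕_
infixl 7 _⊗_
opaque
  _⊕_ _⊗_ : ℚ → ℚ → ℚ
  _⊕_ = ℚ._+_
  _⊗_ = ℚ._*_

  ⊕-⊗-isCommutativeRing : IsCommutativeRing _≡_ _⊕_ _⊗_ ℚ.-_ 0ℚ 1ℚ
  ⊕-⊗-isCommutativeRing = ℚ.+-*-isCommutativeRing

⊕-⊗-commutativeRing : CommutativeRing _ _
⊕-⊗-commutativeRing = record { isCommutativeRing = ⊕-⊗-isCommutativeRing }

open CommutativeRing ⊕-⊗-commutativeRing
  using (+-commutativeSemigroup; *-commutativeSemigroup)
  renaming ( +-assoc to ⊕-assoc; +-identityˡ to ⊕-identityˡ; +-identityʳ to ⊕-identityʳ
           ; *-assoc to ⊗-assoc; *-comm to ⊗-comm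
           ; *-identityˡ to ⊗-identityˡ; *-identityʳ to ⊗-identityʳ
           ; distribˡ to ⊗-distribˡ-⊕; distribʳ to ⊗-distribʳ-⊕
           ; +-congˡ to ⊕-congˡ; +-congʳ to ⊕-congʳ; *-congˡ to ⊗-congˡ; *-congʳ to ⊗-congʳ
           ; zeroˡ to ⊗-zeroˡ; zeroʳ to ⊗-zeroʳ; -‿inverseˡ to ⊕-inverseˡ; -‿inverseʳ to ⊕-inverseʳ)

open import Algebra.Properties.CommutativeSemigroup +-commutativeSemigroup
  using () renaming (interchange to ⊕-interchange; x∙yz≈y∙xz to ⊕-swapˡ)
open import Algebra.Properties.CommutativeSemigroup *-commutativeSemigroup
  using () renaming (interchange to ⊗-interchange; x∙yz≈y∙xz to ⊗-swapˡ)

-- Finite sums of rationals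

∑ᵒ : List A → (A → ℚ) → ℚ
∑ᵒ xs f = foldr (λ x s → f x ⊕ s) 0ℚ xs

∑-cong∈ : (xs : List A) {f g : A → ℚ} → (∀ {x} → x ∈ xs → f x ≡ g x) → ∑ᵒ xs f ≡ ∑ᵒ xs g
∑-cong∈ []       eq = refl
∑-cong∈ (x ∷ xs) eq = cong₂ _⊕_ (eq (here refl)) (∑-cong∈ xs (eq ∘ there))

∑-cong : (xs : List A) {f g : A → ℚ} → (∀ x → f x ≡ g x) → ∑ᵒ xs f ≡ ∑ᵒ xs g
∑-cong xs eq = ∑-cong∈ xs λ {x} _ → eq x

∑-++ : (xs ys : List A) (f : A → ℚ) → ∑ᵒ (xs ++ ys) f ≡ ∑ᵒ xs f ⊕ ∑ᵒ ys f
∑-++ []       ys f = sym (⊕-identityˡ _)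
∑-++ (x ∷ xs) ys f = trans (cong (f x ⊕_) (∑-++ xs ys f)) (sym (⊕-assoc (f x) _ _))

∑-map : (h : A → B) (xs : List A) (f : B → ℚ) → ∑ᵒ (map h xs) f ≡ ∑ᵒ xs (f ∘ h)
∑-map h []       f = refl
∑-map h (x ∷ xs) f = cong (f (h x) ⊕_) (∑-map h xs f)

∑-cartesianProductWith : (h : A → B → C) (xs : List A) (ys : List B) (f : C → ℚ) →
  ∑ᵒ (cartesianProductWith h xs ys) f ≡ ∑ᵒ xs λ x → ∑ᵒ ys λ y → f (h x y)
∑-cartesianProductWith h []       ys f = refl
∑-cartesianProductWith h (x ∷ xs) ys f = trans (∑-++ (map (h x) ys) _ f)
  (cong₂ _⊕_ (∑-map (h x) ys f) (∑-cartesianProductWith h xs ys f))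

∑-zero : (xs : List A) → ∑ᵒ xs (λ _ → 0ℚ) ≡ 0ℚ
∑-zero []       = refl
∑-zero (x ∷ xs) = trans (⊕-identityˡ _) (∑-zero xs)

∑-⊕ : (xs : List A) (f g : A → ℚ) → ∑ᵒ xs (λ x → f x ⊕ g x) ≡ ∑ᵒ xs f ⊕ ∑ᵒ xs g
∑-⊕ []       f g = sym (⊕-identityˡ 0ℚ)
∑-⊕ (x ∷ xs) f g = trans (cong (f x ⊕ g x ⊕_) (∑-⊕ xs f g)) (⊕-interchange (f x) (g x) _ _)

∑-⊗ˡ : (q : ℚ) (xs : List A) (f : A → ℚ) → q ⊗ ∑ᵒ xs f ≡ ∑ᵒ xs λ x → q ⊗ f x
∑-⊗ˡ q []       f = ⊗-zeroʳ q
∑-⊗ˡ q (x ∷ xs) f = trans (⊗-distribˡ-⊕ q (f x) _) (cong (q ⊗ f x ⊕_) (∑-⊗ˡ q xs f))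

∑-⊗ʳ : (q : ℚ) (xs : List A) (f : A → ℚ) → ∑ᵒ xs f ⊗ q ≡ ∑ᵒ xs λ x → f x ⊗ q
∑-⊗ʳ q []       f = ⊗-zeroˡ q
∑-⊗ʳ q (x ∷ xs) f = trans (⊗-distribʳ-⊕ q (f x) _) (cong (f x ⊗ q ⊕_) (∑-⊗ʳ q xs f))

∑-swap : (xs : List A) (ys : List B) (f : A → B → ℚ) →
  ∑ᵒ xs (λ x → ∑ᵒ ys λ y → f x y) ≡ ∑ᵒ ys (λ y → ∑ᵒ xs λ x → f x y)
∑-swap []       ys f = sym (∑-zero ys)
∑-swap (x ∷ xs) ys f =
  trans (cong (∑ᵒ ys (f x) ⊕_) (∑-swap xs ys f)) (sym (∑-⊕ ys (f x) _))

∑-⊗-∑ : (xs : List A) (ys : List B) (f : A → ℚ) (g : B → ℚ) →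
  ∑ᵒ xs f ⊗ ∑ᵒ ys g ≡ ∑ᵒ xs λ x → ∑ᵒ ys λ y → f x ⊗ g y
∑-⊗-∑ xs ys f g = trans (∑-⊗ʳ (∑ᵒ ys g) xs f) (∑-cong xs λ x → ∑-⊗ˡ (f x) ys g)

𝟙 : Bool → ℚ
𝟙 b = if b then 1ℚ else 0ℚ

∑-filter : {P : A → Set} (P? : Decidable P) (xs : List A) (f : A → ℚ) →
  ∑ᵒ (filter P? xs) f ≡ ∑ᵒ xs λ x → 𝟙 (does (P? x)) ⊗ f x
∑-filter P? []       f = refl
∑-filter P? (x ∷ xs) f with P? x
... | yes _ = cong₂ _⊕_ (sym (⊗-identityˡ (f x))) (∑-filter P? xs f)
... | no  _ = trans (∑-filter P? xs f)
  (trans (sym (⊕-identityˡ _)) (⊕-congʳ (sym (⊗-zeroˡ (f x)))))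

-- Coalgebras of splittings

-- Sums over all splittings (a , b) of x; the factorisations of monomials and
-- the products of series are handled through the coalgebra laws below, which
-- splitList inherits from its argument.

Split : Set → Set
Split A = A → List (A × A)

∑ₛ : Split A → A → (A → A → ℚ) → ℚ
∑ₛ split x f = ∑ᵒ (split x) λ (a , b) → f a b

Coassociative : Split A → Set
Coassociative {A} split = ∀ x (f : A → A → A → ℚ) →
  ∑ₛ split x (λ a b → ∑ₛ split a λ c d → f c d b) ≡
  ∑ₛ split x (λ a b → ∑ₛ split b λ c d → f a c d)

Cocommutative : Split A → Set
Cocommutative {A} split = ∀ x (f : A → A → ℚ) → ∑ₛ split x f ≡ ∑ₛ split x λ a b → f b a

Counit : Split A → (A → ℚ) → Set
Counit {A} split ε = ∀ x (f : A → ℚ) → ∑ₛ split x (λ a b → ε a ⊗ f b) ≡ f x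

-- The convolution product dual to the comultiplication `split`; at `factorisations` it is the
-- product of series.
_✶[_]_ : (A → ℚ) → Split A → (A → ℚ) → A → ℚ
(f ✶[ split ] g) x = ∑ₛ split x λ a b → f a ⊗ g b

∏ : (A → ℚ) → List A → ℚ
∏ f = foldr (λ x q → f x ⊗ q) 1ℚ

∑ₛ-cong : (split : Split A) (x : A) {f g : A → A → ℚ} →
  (∀ a b → f a b ≡ g a b) → ∑ₛ split x f ≡ ∑ₛ split x g
∑ₛ-cong split x eq = ∑-cong (split x) λ (a , b) → eq a b

∑ₛ-∷ : (split : Split A) (x : A) (xs : List A) (f : List A → List A → ℚ) →
  ∑ₛ (splitList split) (x ∷ xs) f ≡
  ∑ₛ split x λ a b → ∑ₛ (splitList split) xs λ as bs → f (a ∷ as) (b ∷ bs)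
∑ₛ-∷ split x xs f = ∑-cartesianProductWith _ (split x) (splitList split xs) _

-- Head and tail split independently. Once the sums are exchanged so that both head sums stand
-- outside, the law for the head applies with the tail inert, and then the induction hypothesis
-- applies to the tail.
splitList-coassociative : {split : Split A} → Coassociative split → Coassociative (splitList split)
splitList-coassociative {split = split} coassoc []       f = refl
splitList-coassociative {split = split} coassoc (x ∷ xs) f = begin
  ∑ₛ S (x ∷ xs) (λ a b → ∑ₛ S a λ c d → f c d b)
    ≡⟨ ∑ₛ-∷ split x xs _ ⟩
  ∑ₛ split x (λ a b → ∑ₛ S xs λ as bs → ∑ₛ S (a ∷ as) λ c d → f c d (b ∷ bs))
    ≡⟨ (∑ₛ-cong split x λ a b → ∑ₛ-cong S xs λ as bs → ∑ₛ-∷ split a as _) ⟩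
  ∑ₛ split x (λ a b → ∑ₛ S xs λ as bs → ∑ₛ split a λ c d → ∑ₛ S as λ cs ds →
    f (c ∷ cs) (d ∷ ds) (b ∷ bs))
    ≡⟨ (∑ₛ-cong split x λ a b → ∑-swap (S xs) (split a) _) ⟩
  ∑ₛ split x (λ a b → ∑ₛ split a λ c d → ∑ₛ S xs λ as bs → ∑ₛ S as λ cs ds →
    f (c ∷ cs) (d ∷ ds) (b ∷ bs))
    ≡⟨ coassoc x _ ⟩
  ∑ₛ split x (λ a b → ∑ₛ split b λ c d → ∑ₛ S xs λ as bs → ∑ₛ S as λ cs ds →
    f (a ∷ cs) (c ∷ ds) (d ∷ bs))
    ≡⟨ (∑ₛ-cong split x λ a b → ∑ₛ-cong split b λ c d →
         splitList-coassociative coassoc xs _) ⟩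
  ∑ₛ split x (λ a b → ∑ₛ split b λ c d → ∑ₛ S xs λ as bs → ∑ₛ S bs λ cs ds →
    f (a ∷ as) (c ∷ cs) (d ∷ ds))
    ≡⟨ (∑ₛ-cong split x λ a b → ∑-swap (split b) (S xs) _) ⟩
  ∑ₛ split x (λ a b → ∑ₛ S xs λ as bs → ∑ₛ split b λ c d → ∑ₛ S bs λ cs ds →
    f (a ∷ as) (c ∷ cs) (d ∷ ds))
    ≡⟨ (∑ₛ-cong split x λ a b → ∑ₛ-cong S xs λ as bs → ∑ₛ-∷ split b bs _) ⟨
  ∑ₛ split x (λ a b → ∑ₛ S xs λ as bs → ∑ₛ S (b ∷ bs) λ c d → f (a ∷ as) c d)
    ≡⟨ ∑ₛ-∷ split x xs _ ⟨
  ∑ₛ S (x ∷ xs) (λ a b → ∑ₛ S b λ c d → f a c d) ∎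
  where S = splitList split

splitList-cocommutative : {split : Split A} → Cocommutative split → Cocommutative (splitList split)
splitList-cocommutative {split = split} cocomm []       f = refl
splitList-cocommutative {split = split} cocomm (x ∷ xs) f = begin
  ∑ₛ S (x ∷ xs) f
    ≡⟨ ∑ₛ-∷ split x xs f ⟩
  ∑ₛ split x (λ a b → ∑ₛ S xs λ as bs → f (a ∷ as) (b ∷ bs))
    ≡⟨ cocomm x _ ⟩
  ∑ₛ split x (λ a b → ∑ₛ S xs λ as bs → f (b ∷ as) (a ∷ bs))
    ≡⟨ (∑ₛ-cong split x λ a b → splitList-cocommutative cocomm xs _) ⟩
  ∑ₛ split x (λ a b → ∑ₛ S xs λ as bs → f (b ∷ bs) (a ∷ as))
    ≡⟨ ∑ₛ-∷ split x xs _ ⟨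
  ∑ₛ S (x ∷ xs) (λ a b → f b a) ∎
  where S = splitList split

-- Products of weights in separate variables convolve variable by variable. Applied to rows and then
-- to monomials, this lifts a one-variable identity to all indeterminates.
splitList-∏ : {split : Split A} {f g h : A → ℚ} → (∀ x → (f ✶[ split ] g) x ≡ h x) →
  ∀ xs → (∏ f ✶[ splitList split ] ∏ g) xs ≡ ∏ h xs
splitList-∏ eq [] = trans (⊕-identityʳ _) (⊗-identityˡ 1ℚ)
splitList-∏ {split = split} {f} {g} {h} eq (x ∷ xs) = begin
  ∑ₛ S (x ∷ xs) (λ as bs → ∏ f as ⊗ ∏ g bs)
    ≡⟨ ∑ₛ-∷ split x xs _ ⟩
  ∑ₛ split x (λ a b → ∑ₛ S xs λ as bs → f a ⊗ ∏ f as ⊗ (g b ⊗ ∏ g bs))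
    ≡⟨ (∑ₛ-cong split x λ a b → ∑ₛ-cong S xs λ as bs →
         ⊗-interchange (f a) (∏ f as) (g b) (∏ g bs)) ⟩
  ∑ₛ split x (λ a b → ∑ₛ S xs λ as bs → f a ⊗ g b ⊗ (∏ f as ⊗ ∏ g bs))
    ≡⟨ ∑-⊗-∑ (split x) (S xs) _ _ ⟨
  (f ✶[ split ] g) x ⊗ (∏ f ✶[ S ] ∏ g) xs
    ≡⟨ cong₂ _⊗_ (eq x) (splitList-∏ eq xs) ⟩
  h x ⊗ ∏ h xs ∎
  where S = splitList split

splitList-counit : {split : Split A} {ε : A → ℚ} →
  Counit split ε → Counit (splitList split) (∏ ε)
splitList-counit counit [] f = trans (⊕-identityʳ _) (⊗-identityˡ (f []))
splitList-counit {split = split} {ε} counit (x ∷ xs) f = begin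
  ∑ₛ S (x ∷ xs) (λ as bs → ∏ ε as ⊗ f bs)
    ≡⟨ ∑ₛ-∷ split x xs _ ⟩
  ∑ₛ split x (λ a b → ∑ₛ S xs λ as bs → ε a ⊗ ∏ ε as ⊗ f (b ∷ bs))
    ≡⟨ (∑ₛ-cong split x λ a b → ∑ₛ-cong S xs λ as bs → ⊗-assoc (ε a) (∏ ε as) _) ⟩
  ∑ₛ split x (λ a b → ∑ₛ S xs λ as bs → ε a ⊗ (∏ ε as ⊗ f (b ∷ bs)))
    ≡⟨ (∑ₛ-cong split x λ a b → ∑-⊗ˡ (ε a) (S xs) _) ⟨
  ∑ₛ split x (λ a b → ε a ⊗ ∑ₛ S xs λ as bs → ∏ ε as ⊗ f (b ∷ bs))
    ≡⟨ (∑ₛ-cong split x λ a b → cong (ε a ⊗_) (splitList-counit counit xs _)) ⟩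
  ∑ₛ split x (λ a b → ε a ⊗ f (b ∷ xs))
    ≡⟨ counit x _ ⟩
  f (x ∷ xs) ∎
  where S = splitList split

-- The coalgebra of exponents

splitℕ-suc : ∀ e → splitℕ (suc e) ≡ (0 , suc e) ∷ map (map₁ suc) (splitℕ e)
splitℕ-suc e = cong ((0 , suc e) ∷_) (begin
  map (λ a → a , suc e ℕ.∸ a) (applyUpTo suc (suc e))
    ≡⟨ map-applyUpTo suc _ (suc e) ⟩
  applyUpTo (λ a → suc a , e ℕ.∸ a) (suc e)
    ≡⟨ map-applyUpTo (λ a → a , e ℕ.∸ a) (map₁ suc) (suc e) ⟨
  map (map₁ suc) (applyUpTo (λ a → a , e ℕ.∸ a) (suc e))
    ≡⟨ cong (map (map₁ suc)) (map-applyUpTo id (λ a → a , e ℕ.∸ a) (suc e)) ⟨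
  map (map₁ suc) (splitℕ e) ∎)

∑ₛ-sucˡ : ∀ e (f : ℕ → ℕ → ℚ) → ∑ₛ splitℕ (suc e) f ≡ f 0 (suc e) ⊕ ∑ₛ splitℕ e λ a b → f (suc a) b
∑ₛ-sucˡ e f = trans (cong (λ xs → ∑ᵒ xs λ (a , b) → f a b) (splitℕ-suc e))
  (cong (f 0 (suc e) ⊕_) (∑-map (map₁ suc) (splitℕ e) _))

-- `splitℕ` lists its pairs by increasing first component, so only the recursion from the left is
-- close to its definition. Cocommutativity exchanges the two ends and needs this mirror image.
∑ₛ-sucʳ : ∀ e (f : ℕ → ℕ → ℚ) → ∑ₛ splitℕ (suc e) f ≡ f (suc e) 0 ⊕ ∑ₛ splitℕ e λ a b → f a (suc b)
∑ₛ-sucʳ zero    f = ⊕-swapˡ (f 0 1) (f 1 0) 0ℚ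
∑ₛ-sucʳ (suc e) f = begin
  ∑ₛ splitℕ (suc (suc e)) f
    ≡⟨ ∑ₛ-sucˡ (suc e) f ⟩
  f 0 (suc (suc e)) ⊕ ∑ₛ splitℕ (suc e) (λ a b → f (suc a) b)
    ≡⟨ cong (f 0 (suc (suc e)) ⊕_) (∑ₛ-sucʳ e _) ⟩
  f 0 (suc (suc e)) ⊕ (f (suc (suc e)) 0 ⊕ ∑ₛ splitℕ e λ a b → f (suc a) (suc b))
    ≡⟨ ⊕-swapˡ (f 0 (suc (suc e))) _ _ ⟩
  f (suc (suc e)) 0 ⊕ (f 0 (suc (suc e)) ⊕ ∑ₛ splitℕ e λ a b → f (suc a) (suc b))
    ≡⟨ cong (f (suc (suc e)) 0 ⊕_) (∑ₛ-sucˡ e _) ⟨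
  f (suc (suc e)) 0 ⊕ ∑ₛ splitℕ (suc e) (λ a b → f a (suc b)) ∎

splitℕ-cocommutative : Cocommutative splitℕ
splitℕ-cocommutative zero    f = refl
splitℕ-cocommutative (suc e) f = begin
  ∑ₛ splitℕ (suc e) f
    ≡⟨ ∑ₛ-sucˡ e f ⟩
  f 0 (suc e) ⊕ ∑ₛ splitℕ e (λ a b → f (suc a) b)
    ≡⟨ cong (f 0 (suc e) ⊕_) (splitℕ-cocommutative e _) ⟩
  f 0 (suc e) ⊕ ∑ₛ splitℕ e (λ a b → f (suc b) a)
    ≡⟨ ∑ₛ-sucʳ e _ ⟨
  ∑ₛ splitℕ (suc e) (λ a b → f b a) ∎

-- On both sides the triples with first component 0 are set apart; they sum `f 0` over all
-- splittings. The others form the same statement for e, with the first argument of f shifted by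
-- one.
splitℕ-coassociative : Coassociative splitℕ
splitℕ-coassociative zero    f = refl
splitℕ-coassociative (suc e) f = begin
  ∑ₛ splitℕ (suc e) (λ a b → ∑ₛ splitℕ a λ c d → f c d b)
    ≡⟨ ∑ₛ-sucˡ e _ ⟩
  f 0 0 (suc e) ⊕ 0ℚ ⊕ ∑ₛ splitℕ e (λ a b → ∑ₛ splitℕ (suc a) λ c d → f c d b)
    ≡⟨ cong₂ _⊕_ (⊕-identityʳ (f 0 0 (suc e))) (begin
      ∑ₛ splitℕ e (λ a b → ∑ₛ splitℕ (suc a) λ c d → f c d b)
        ≡⟨ (∑ₛ-cong splitℕ e λ a b → ∑ₛ-sucˡ a _) ⟩
      ∑ₛ splitℕ e (λ a b → f 0 (suc a) b ⊕ ∑ₛ splitℕ a λ c d → f (suc c) d b)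
        ≡⟨ ∑-⊕ (splitℕ e) _ _ ⟩
      ∑ₛ splitℕ e (λ a b → f 0 (suc a) b) ⊕
      ∑ₛ splitℕ e (λ a b → ∑ₛ splitℕ a λ c d → f (suc c) d b)
        ≡⟨ ⊕-congˡ (splitℕ-coassociative e _) ⟩
      ∑ₛ splitℕ e (λ a b → f 0 (suc a) b) ⊕
      ∑ₛ splitℕ e (λ a b → ∑ₛ splitℕ b λ c d → f (suc a) c d) ∎) ⟩
  f 0 0 (suc e) ⊕ (∑ₛ splitℕ e (λ a b → f 0 (suc a) b) ⊕
  ∑ₛ splitℕ e (λ a b → ∑ₛ splitℕ b λ c d → f (suc a) c d))
    ≡⟨ ⊕-assoc (f 0 0 (suc e)) _ _ ⟨
  f 0 0 (suc e) ⊕ ∑ₛ splitℕ e (λ a b → f 0 (suc a) b) ⊕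
  ∑ₛ splitℕ e (λ a b → ∑ₛ splitℕ b λ c d → f (suc a) c d)
    ≡⟨ ⊕-congʳ (∑ₛ-sucˡ e _) ⟨
  ∑ₛ splitℕ (suc e) (f 0) ⊕ ∑ₛ splitℕ e (λ a b → ∑ₛ splitℕ b λ c d → f (suc a) c d)
    ≡⟨ ∑ₛ-sucˡ e _ ⟨
  ∑ₛ splitℕ (suc e) (λ a b → ∑ₛ splitℕ b λ c d → f a c d) ∎

∑ₛ-zero : (split : Split A) (x : A) {f : A → A → ℚ} →
  (∀ a b → f a b ≡ 0ℚ) → ∑ₛ split x f ≡ 0ℚ
∑ₛ-zero split x eq = trans (∑ₛ-cong split x eq) (∑-zero (split x))

splitℕ-counit : Counit splitℕ (λ e → 𝟙 (does (e ℕ.≟ 0)))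
splitℕ-counit zero    f = trans (⊕-identityʳ _) (⊗-identityˡ (f 0))
splitℕ-counit (suc e) f = trans (∑ₛ-sucˡ e _) (trans
  (cong₂ _⊕_ (⊗-identityˡ (f (suc e))) (∑ₛ-zero splitℕ e λ a b → ⊗-zeroˡ (f b)))
  (⊕-identityʳ _))

𝟙-yes : {P : Set} (P? : Dec P) → P → 𝟙 (does P?) ≡ 1ℚ
𝟙-yes P? p = cong 𝟙 (dec-true P? p)

𝟙-no : {P : Set} (P? : Dec P) → ¬ P → 𝟙 (does P?) ≡ 0ℚ
𝟙-no P? ¬p = cong 𝟙 (dec-false P? ¬p)

-- Factorisations as a pointwise relation

data Zip (R : A → A → A → Set) : List A → List A → List A → Set where
  []  : Zip R [] [] []
  _∷_ : ∀ {x a b xs as bs} → R x a b → Zip R xs as bs → Zip R (x ∷ xs) (a ∷ as) (b ∷ bs)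

-- Trades membership in nested Cartesian products for a relation that supports induction along the
-- monomial.
∈-splitList⁻ : {split : Split A} {R : A → A → A → Set} →
  (∀ {x a b} → (a , b) ∈ split x → R x a b) →
  ∀ {xs as bs} → (as , bs) ∈ splitList split xs → Zip R xs as bs
∈-splitList⁻ r {[]} (here refl) = []
∈-splitList⁻ {split = split} r {x ∷ xs} i
  with ∈-cartesianProductWith⁻ _ (split x) (splitList split xs) i
... | _ , _ , j , k , refl = r j ∷ ∈-splitList⁻ r k

∈-splitList⁺ : {split : Split A} {R : A → A → A → Set} →
  (∀ {x a b} → R x a b → (a , b) ∈ split x) →
  ∀ {xs as bs} → Zip R xs as bs → (as , bs) ∈ splitList split xs
∈-splitList⁺ r []       = here refl
∈-splitList⁺ r (p ∷ ps) = ∈-cartesianProductWith⁺ _ (r p) (∈-splitList⁺ r ps)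

Sums : ℕ → ℕ → ℕ → Set
Sums e a b = a ℕ.+ b ≡ e

∈-splitℕ⁻ : ∀ {e a b} → (a , b) ∈ splitℕ e → Sums e a b
∈-splitℕ⁻ i with ∈-map⁻ _ i
... | _ , j , refl = ℕ.m+[n∸m]≡n (ℕ.<⇒≤pred (∈-upTo⁻ j))

∈-splitℕ⁺ : ∀ {e a b} → Sums e a b → (a , b) ∈ splitℕ e
∈-splitℕ⁺ {e} {a} {b} refl = subst (λ x → (a , x) ∈ splitℕ (a ℕ.+ b)) (ℕ.m+n∸m≡n a b)
  (∈-map⁺ (λ x → x , a ℕ.+ b ℕ.∸ x) (∈-upTo⁺ (ℕ.s≤s (ℕ.m≤m+n a b))))

Factors : Monomial → Monomial → Monomial → Set
Factors = Zip (Zip Sums)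

∈-factorisations⁻ : ∀ {m u v} → (u , v) ∈ factorisations m → Factors m u v
∈-factorisations⁻ = ∈-splitList⁻ (∈-splitList⁻ ∈-splitℕ⁻)

∈-factorisations⁺ : ∀ {m u v} → Factors m u v → (u , v) ∈ factorisations m
∈-factorisations⁺ = ∈-splitList⁺ (∈-splitList⁺ ∈-splitℕ⁺)

sum-Zip : ∀ {r a b} → Zip Sums r a b → sum a ℕ.+ sum b ≡ sum r
sum-Zip [] = refl
sum-Zip (_∷_ {_} {a} {b} {_} {as} {bs} refl ps) =
  trans (lemma a (sum as) b (sum bs)) (cong (a ℕ.+ b ℕ.+_) (sum-Zip ps))
  where
  lemma : ∀ a as b bs → a ℕ.+ as ℕ.+ (b ℕ.+ bs) ≡ a ℕ.+ b ℕ.+ (as ℕ.+ bs)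
  lemma = solve-∀

degreeFrom-Factors : ∀ i {m u v} → Factors m u v →
  degreeFrom i u ℕ.+ degreeFrom i v ≡ degreeFrom i m
degreeFrom-Factors i [] = refl
degreeFrom-Factors i (_∷_ {_} {a} {b} {_} {as} {bs} p ps) =
  trans (lemma (suc i) (sum a) (degreeFrom (suc i) as) (sum b) (degreeFrom (suc i) bs))
    (cong₂ (λ x y → suc i ℕ.* x ℕ.+ y) (sum-Zip p) (degreeFrom-Factors (suc i) ps))
  where
  lemma : ∀ i a as b bs → i ℕ.* a ℕ.+ as ℕ.+ (i ℕ.* b ℕ.+ bs) ≡ i ℕ.* (a ℕ.+ b) ℕ.+ (as ℕ.+ bs)
  lemma = solve-∀

-- Square-free series as products of binomials

-- E_{d^r} and E⁺_{d^r} are the degree d * r parts of the products of 1 + c x ^ r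
-- over all indeterminates x, for c = -1 and c = 1.  Thus wt c r e is the
-- coefficient of x ^ e in 1 + c x ^ r.
wt : ℚ → ℕ → ℕ → ℚ
wt c r e = if does (e ℕ.≟ 0) then 1ℚ else if does (e ℕ.≟ r) then c else 0ℚ

binomials : ℚ → ℕ → Series
binomials c r = ∏ (∏ (wt c r))

squareFree : ℚ → ℕ → ℕ → Series
squareFree c d r m = 𝟙 (does (deg m ℕ.≟ d ℕ.* r)) ⊗ binomials c r m

wt-∣ : ∀ c r e → r ∣ e ⊎ wt c r e ≡ 0ℚ
wt-∣ c r zero = inj₁ (r ∣0)
wt-∣ c r (suc e) with suc e ℕ.≟ r
... | yes refl = inj₁ ∣-refl
... | no e≢r   = inj₂ (cong (λ b → if b then c else 0ℚ) (dec-false (suc e ℕ.≟ r) e≢r))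

-- One vanishing factor kills the product; otherwise every factor supplies its witness. Statements
-- about supports take this disjunctive form throughout, which passes through products and sums.
∏-All : {P : A → Set} {f : A → ℚ} → (∀ x → P x ⊎ f x ≡ 0ℚ) → ∀ xs → All P xs ⊎ ∏ f xs ≡ 0ℚ
∏-All         h []       = inj₁ []
∏-All {f = f} h (x ∷ xs) with h x | ∏-All h xs
... | inj₁ p | inj₁ ps = inj₁ (p ∷ ps)
... | inj₁ p | inj₂ eq = inj₂ (trans (⊗-congˡ eq) (⊗-zeroʳ (f x)))
... | inj₂ eq | _      = inj₂ (trans (⊗-congʳ eq) (⊗-zeroˡ _))

binomials-∣ : ∀ c r m → All (All (r ∣_)) m ⊎ binomials c r m ≡ 0ℚ
binomials-∣ c r = ∏-All (∏-All (wt-∣ c r))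

∣sum : ∀ {r es} → All (r ∣_) es → r ∣ sum es
∣sum []       = _ ∣0
∣sum (p ∷ ps) = ∣m∣n⇒∣m+n p (∣sum ps)

∣degreeFrom : ∀ {r} i {m} → All (All (r ∣_)) m → r ∣ degreeFrom i m
∣degreeFrom i []       = _ ∣0
∣degreeFrom i (p ∷ ps) = ∣m∣n⇒∣m+n (∣n⇒∣m*n (suc i) (∣sum p)) (∣degreeFrom (suc i) ps)

module _ (r : ℕ) .{{_ : NonZero r}} where

  sum-root : ∀ {es} → All (r ∣_) es → sum es ≡ sum (map (ℕ._/ r) es) ℕ.* r
  sum-root []       = refl
  sum-root {e ∷ es} (p ∷ ps) = trans (cong₂ ℕ._+_ (sym (m/n*n≡m p)) (sum-root ps))
    (sym (ℕ.*-distribʳ-+ r (e ℕ./ r) _))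

  degreeFrom-root : ∀ i {m} → All (All (r ∣_)) m →
    degreeFrom i m ≡ degreeFrom i (map (map (ℕ._/ r)) m) ℕ.* r
  degreeFrom-root i []       = refl
  degreeFrom-root i {es ∷ m} (p ∷ ps) = trans
    (cong₂ (λ x y → suc i ℕ.* x ℕ.+ y) (sum-root p) (degreeFrom-root (suc i) ps))
    (lemma (suc i) (sum (map (ℕ._/ r) es)) r (degreeFrom (suc i) (map (map (ℕ._/ r)) m)))
    where
    lemma : ∀ i x r y → i ℕ.* (x ℕ.* r) ℕ.+ y ℕ.* r ≡ (i ℕ.* x ℕ.+ y) ℕ.* r
    lemma = solve-∀

  wt-power : ∀ c q → wt c r (q ℕ.* r) ≡ wt c 1 q
  wt-power c zero = refl
  wt-power c (suc q)
    rewrite dec-false (suc q ℕ.* r ℕ.≟ 0) (ℕ.≢-nonZero⁻¹ (suc q ℕ.* r) {{ℕ.m*n≢0 (suc q) r}})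
    = cong (λ b → if b then c else 0ℚ) (does-⇔ (mk⇔
        (λ eq → ℕ.*-cancelʳ-≡ (suc q) 1 r (trans eq (sym (ℕ.*-identityˡ r))))
        (λ eq → trans (cong (ℕ._* r) eq) (ℕ.*-identityˡ r)))
        (suc q ℕ.* r ℕ.≟ r) (suc q ℕ.≟ 1))

  wt-root : ∀ c {e} → r ∣ e → wt c r e ≡ wt c 1 (e ℕ./ r)
  wt-root c (divides q refl) = trans (wt-power c q) (cong (wt c 1) (sym (m*n/n≡m q r)))

∏-map : {P : A → Set} {f g : A → ℚ} {h : A → A} → (∀ {x} → P x → f x ≡ g (h x)) →
  ∀ {xs} → All P xs → ∏ f xs ≡ ∏ g (map h xs)
∏-map eq []       = refl
∏-map eq (p ∷ ps) = cong₂ _⊗_ (eq p) (∏-map eq ps)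

if-⊗ : ∀ b c {x y : ℚ} →
  (if b then x else 0ℚ) ⊗ (if c then y else 0ℚ) ≡ (if b ∧ c then x ⊗ y else 0ℚ)
if-⊗ false c     = ⊗-zeroˡ _
if-⊗ true  false = ⊗-zeroʳ _
if-⊗ true  true  = refl

module _ {c : ℚ} {s : ℕ → ℚ} (s-zero : s 0 ≡ 1ℚ) (s-suc : ∀ k → s (suc k) ≡ c ⊗ s k) where

  s-+ : ∀ j k → s (j ℕ.+ k) ≡ s j ⊗ s k
  s-+ zero    k = sym (trans (⊗-congʳ s-zero) (⊗-identityˡ (s k)))
  s-+ (suc j) k = begin
    s (suc (j ℕ.+ k))  ≡⟨ s-suc (j ℕ.+ k) ⟩
    c ⊗ s (j ℕ.+ k)    ≡⟨ ⊗-congˡ (s-+ j k) ⟩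
    c ⊗ (s j ⊗ s k)    ≡⟨ ⊗-assoc c (s j) (s k) ⟨
    c ⊗ s j ⊗ s k      ≡⟨ ⊗-congʳ (s-suc j) ⟨
    s (suc j) ⊗ s k    ∎

  s-one : s 1 ≡ c
  s-one = trans (s-suc 0) (trans (⊗-congˡ s-zero) (⊗-identityʳ c))

  wt-one : ∀ e → wt c 1 e ≡ (if does (e ℕ.≤? 1) then s (length (filter (1 ℕ.≤?_) (e ∷ []))) else 0ℚ)
  wt-one 0             = sym s-zero
  wt-one 1             = sym s-one
  wt-one (suc (suc e)) = refl

  length-filter-++ : (es fs : List ℕ) → s (length (filter (1 ℕ.≤?_) (es ++ fs))) ≡
    s (length (filter (1 ℕ.≤?_) es)) ⊗ s (length (filter (1 ℕ.≤?_) fs))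
  length-filter-++ es fs = trans
    (cong s (trans (cong length (filter-++ (1 ℕ.≤?_) es fs)) (length-++ (filter (1 ℕ.≤?_) es))))
    (s-+ (length (filter (1 ℕ.≤?_) es)) _)

  ∏-wt-one : ∀ es → ∏ (wt c 1) es ≡
    (if does (all? (ℕ._≤? 1) es) then s (length (filter (1 ℕ.≤?_) es)) else 0ℚ)
  ∏-wt-one []       = sym s-zero
  ∏-wt-one (e ∷ es) = begin
    wt c 1 e ⊗ ∏ (wt c 1) es
      ≡⟨ cong₂ _⊗_ (wt-one e) (∏-wt-one es) ⟩
    _ ≡⟨ if-⊗ (does (e ℕ.≤? 1)) (does (all? (ℕ._≤? 1) es)) ⟩
    (if does (all? (ℕ._≤? 1) (e ∷ es)) then _ else 0ℚ)
      ≡⟨ cong (if does (all? (ℕ._≤? 1) (e ∷ es)) then_else 0ℚ) (length-filter-++ (e ∷ []) es) ⟨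
    _ ∎

  binomials-one : ∀ m → binomials c 1 m ≡
    (if does (all? (all? (ℕ._≤? 1)) m) then s (numVars m) else 0ℚ)
  binomials-one []       = sym s-zero
  binomials-one (es ∷ m) = begin
    ∏ (wt c 1) es ⊗ binomials c 1 m
      ≡⟨ cong₂ _⊗_ (∏-wt-one es) (binomials-one m) ⟩
    _ ≡⟨ if-⊗ (does (all? (ℕ._≤? 1) es)) (does (all? (all? (ℕ._≤? 1)) m)) ⟩
    _ ≡⟨ cong (if does (all? (all? (ℕ._≤? 1)) (es ∷ m)) then_else 0ℚ) (length-filter-++ es (concat m)) ⟨
    _ ∎

  -- Covers `E-deg` (`s` is `sign`, c = -1) and `E⁺-deg` (`s` is constantly 1) at once. If r divides
  -- all exponents, both sides are compared at the r-th root of m. Otherwise some exponent is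
  -- neither 0 nor r, and its weight makes the right side vanish as well.
  substPower-squareFree : ∀ d r .{{_ : NonZero r}} m →
    substPower r (λ m → if isSquareFreeOfDegree d m then s (numVars m) else 0ℚ) m ≡ squareFree c d r m
  substPower-squareFree d r m with all? (all? (r ∣?_)) m
  ... | yes p = begin
    (if does (all? (all? (ℕ._≤? 1)) m′) ∧ does (deg m′ ℕ.≟ d) then s (numVars m′) else 0ℚ)
      ≡⟨ cong (if does (all? (all? (ℕ._≤? 1)) m′) ∧ does (deg m′ ℕ.≟ d) then_else 0ℚ) (⊗-identityʳ _) ⟨
    _ ≡⟨ if-⊗ (does (all? (all? (ℕ._≤? 1)) m′)) (does (deg m′ ℕ.≟ d)) ⟨
    _ ≡⟨ ⊗-comm _ _ ⟩
    𝟙 (does (deg m′ ℕ.≟ d)) ⊗ (if does (all? (all? (ℕ._≤? 1)) m′) then s (numVars m′) else 0ℚ)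
      ≡⟨ cong₂ _⊗_ (cong 𝟙 (does-⇔ (mk⇔
           (λ eq → trans (degreeFrom-root r 0 p) (cong (ℕ._* r) eq))
           (λ eq → ℕ.*-cancelʳ-≡ (deg m′) d r (trans (sym (degreeFrom-root r 0 p)) eq)))
           (deg m′ ℕ.≟ d) (deg m ℕ.≟ d ℕ.* r)))
           (sym (binomials-one m′)) ⟩
    𝟙 (does (deg m ℕ.≟ d ℕ.* r)) ⊗ binomials c 1 m′
      ≡⟨ ⊗-congˡ (∏-map (∏-map (wt-root r c)) p) ⟨
    𝟙 (does (deg m ℕ.≟ d ℕ.* r)) ⊗ binomials c r m ∎
    where m′ = map (map (ℕ._/ r)) m
  ... | no ¬p with binomials-∣ c r m
  ...   | inj₁ p  = contradiction p ¬p
  ...   | inj₂ eq = sym (trans (⊗-congˡ eq) (⊗-zeroʳ _))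

-- The conjugate product in one variable

-- The coefficient at e of x ^ q times the power series f.
shift : ℕ → (ℕ → ℚ) → ℕ → ℚ
shift zero    f e       = f e
shift (suc q) f zero    = 0ℚ
shift (suc q) f (suc e) = shift q f e

shift-+ : ∀ q f k → shift q f (q ℕ.+ k) ≡ f k
shift-+ zero    f k = refl
shift-+ (suc q) f k = shift-+ q f k

shift-< : ∀ {q e} f → e ℕ.< q → shift q f e ≡ 0ℚ
shift-< {suc q} {zero}  f e<q         = refl
shift-< {suc q} {suc e} f (ℕ.s≤s e<q) = shift-< f e<q

-- Convolving with the indicator of q multiplies by x^q, so that 1 + x^r acts as the identity plus a
-- shift.
∑ₛ-shift : ∀ q e f → ∑ₛ splitℕ e (λ a b → 𝟙 (does (a ℕ.≟ q)) ⊗ f b) ≡ shift q f e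
∑ₛ-shift zero    e       f = splitℕ-counit e f
∑ₛ-shift (suc q) zero    f = trans (⊕-identityʳ _) (⊗-zeroˡ (f 0))
∑ₛ-shift (suc q) (suc e) f = trans (∑ₛ-sucˡ e _)
  (trans (cong₂ _⊕_ (⊗-zeroˡ (f (suc e))) (∑ₛ-shift q e f)) (⊕-identityˡ _))

-1ℚ : ℚ
-1ℚ = ℚ.- 1ℚ

module _ (r : ℕ) .{{_ : NonZero r}} where

  wt-positive : ∀ a → wt 1ℚ r a ≡ 𝟙 (does (a ℕ.≟ 0)) ⊕ 𝟙 (does (a ℕ.≟ r))
  wt-positive zero = sym (trans
    (⊕-congˡ (𝟙-no (0 ℕ.≟ r) λ eq → ℕ.≢-nonZero⁻¹ r (sym eq))) (⊕-identityʳ 1ℚ))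
  wt-positive (suc a) = sym (⊕-identityˡ _)

  wt-r : ∀ c → wt c r r ≡ c
  wt-r c rewrite dec-false (r ℕ.≟ 0) (ℕ.≢-nonZero⁻¹ r) | dec-true (r ℕ.≟ r) refl = refl

wt-other : ∀ r c {e} → e ≢ 0 → e ≢ r → wt c r e ≡ 0ℚ
wt-other r c {e} e≢0 e≢r rewrite dec-false (e ℕ.≟ 0) e≢0 | dec-false (e ℕ.≟ r) e≢r = refl

-- (1 + x ^ r) (1 - x ^ r) = 1 - x ^ 2r
wt-conjugate : ∀ r .{{_ : NonZero r}} e →
  (wt 1ℚ r ✶[ splitℕ ] wt -1ℚ r) e ≡ wt -1ℚ (2 ℕ.* r) e
wt-conjugate r e = begin
  ∑ₛ splitℕ e (λ a b → wt 1ℚ r a ⊗ w b)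
    ≡⟨ (∑ₛ-cong splitℕ e λ a b → trans (⊗-congʳ (wt-positive r a)) (⊗-distribʳ-⊕ (w b) _ _)) ⟩
  ∑ₛ splitℕ e (λ a b → 𝟙 (does (a ℕ.≟ 0)) ⊗ w b ⊕ 𝟙 (does (a ℕ.≟ r)) ⊗ w b)
    ≡⟨ ∑-⊕ (splitℕ e) _ _ ⟩
  _ ≡⟨ cong₂ _⊕_ (splitℕ-counit e w) (∑ₛ-shift r e w) ⟩
  w e ⊕ shift r w e
    ≡⟨ cases (ℕ.≤-<-connex r e) ⟩
  wt -1ℚ (2 ℕ.* r) e ∎
  where
  instance
    2r≢0 : NonZero (2 ℕ.* r)
    2r≢0 = ℕ.m*n≢0 2 r
  w = wt -1ℚ r
  r≢0 = ℕ.≢-nonZero⁻¹ r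
  -- With e = r + k, the two terms cancel at k = 0, give the coefficient -1 of x^(2r) at k = r, and
  -- are both zero for every other k.
  at : ∀ k → Dec (k ≡ 0) → Dec (k ≡ r) → w (r ℕ.+ k) ⊕ w k ≡ wt -1ℚ (2 ℕ.* r) (r ℕ.+ k)
  at k (yes refl) _ = trans
    (⊕-congʳ (trans (cong w (ℕ.+-identityʳ r)) (wt-r r -1ℚ)))
    (trans (⊕-inverseˡ 1ℚ) (sym (trans (cong (wt -1ℚ (2 ℕ.* r)) (ℕ.+-identityʳ r))
      (wt-other (2 ℕ.* r) -1ℚ r≢0 λ eq → r≢0 (sym (trans
        (ℕ.+-cancelˡ-≡ r 0 (r ℕ.+ 0) (trans (ℕ.+-identityʳ r) eq)) (ℕ.+-identityʳ r)))))))
  at k (no _) (yes refl) = trans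
    (cong₂ _⊕_ (wt-other r -1ℚ (r≢0 ∘ ℕ.m+n≡0⇒m≡0 r)
       λ eq → r≢0 (ℕ.+-cancelˡ-≡ r r 0 (trans eq (sym (ℕ.+-identityʳ r))))) (wt-r r -1ℚ))
    (trans (⊕-identityˡ -1ℚ) (sym (trans
      (cong (λ x → wt -1ℚ (2 ℕ.* r) (r ℕ.+ x)) (sym (ℕ.+-identityʳ r))) (wt-r (2 ℕ.* r) -1ℚ))))
  at k (no k≢0) (no k≢r) = trans
    (cong₂ _⊕_ (wt-other r -1ℚ (r≢0 ∘ ℕ.m+n≡0⇒m≡0 r)
       λ eq → k≢0 (ℕ.+-cancelˡ-≡ r k 0 (trans eq (sym (ℕ.+-identityʳ r)))))
       (wt-other r -1ℚ k≢0 k≢r))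
    (trans (⊕-identityˡ 0ℚ) (sym (wt-other (2 ℕ.* r) -1ℚ (r≢0 ∘ ℕ.m+n≡0⇒m≡0 r)
      λ eq → k≢r (trans (ℕ.+-cancelˡ-≡ r k (r ℕ.+ 0) eq) (ℕ.+-identityʳ r)))))
  cases : r ℕ.≤ e ⊎ e ℕ.< r → w e ⊕ shift r w e ≡ wt -1ℚ (2 ℕ.* r) e
  cases (inj₁ r≤e) with k , refl ← ℕ.m≤n⇒∃[o]m+o≡n r≤e =
    trans (⊕-congˡ (shift-+ r w k)) (at k (k ℕ.≟ 0) (k ℕ.≟ r))
  cases (inj₂ e<r) = trans (trans (⊕-congˡ (shift-< w e<r)) (⊕-identityʳ (w e))) (below (e ℕ.≟ 0))
    where
    below : Dec (e ≡ 0) → w e ≡ wt -1ℚ (2 ℕ.* r) e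
    below (yes refl) = refl
    below (no e≢0) = trans (wt-other r -1ℚ e≢0 (ℕ.<⇒≢ e<r)) (sym (wt-other (2 ℕ.* r) -1ℚ e≢0
      (ℕ.<⇒≢ (ℕ.<-≤-trans e<r (ℕ.m≤m+n r _)))))

-- The conjugate product in all variables

infixl 7 _✶_
_✶_ : Series → Series → Series
F ✶ G = F ✶[ factorisations ] G

binomials-conjugate : ∀ r .{{_ : NonZero r}} m → (binomials 1ℚ r ✶ binomials -1ℚ r) m ≡ binomials -1ℚ (2 ℕ.* r) m
binomials-conjugate r = splitList-∏ (splitList-∏ (wt-conjugate r))

-- Since x = q r, only a = q contributes, and the condition left on b = d - q is the one on the
-- total. For q > d no such b exists, and x + y already exceeds d r.
degree-convolution : ∀ r .{{_ : NonZero r}} d {x} y → r ∣ x →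
  ∑ₛ splitℕ d (λ a b → 𝟙 (does (x ℕ.≟ a ℕ.* r)) ⊗ 𝟙 (does (y ℕ.≟ b ℕ.* r))) ≡
  𝟙 (does (x ℕ.+ y ℕ.≟ d ℕ.* r))
degree-convolution r d {x} y (divides q refl) = begin
  _ ≡⟨ (∑ₛ-cong splitℕ d λ a b → ⊗-congʳ (cong 𝟙 (does-⇔ (mk⇔
         (λ eq → sym (ℕ.*-cancelʳ-≡ q a r eq)) (λ eq → cong (ℕ._* r) (sym eq)))
         (q ℕ.* r ℕ.≟ a ℕ.* r) (a ℕ.≟ q)))) ⟩
  _ ≡⟨ ∑ₛ-shift q d f ⟩
  shift q f d ≡⟨ cases (ℕ.≤-<-connex q d) ⟩
  _ ∎
  where
  f : ℕ → ℚ
  f b = 𝟙 (does (y ℕ.≟ b ℕ.* r))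
  cases : q ℕ.≤ d ⊎ d ℕ.< q → shift q f d ≡ 𝟙 (does (q ℕ.* r ℕ.+ y ℕ.≟ d ℕ.* r))
  cases (inj₁ q≤d) with k , refl ← ℕ.m≤n⇒∃[o]m+o≡n q≤d = trans (shift-+ q f k)
    (cong 𝟙 (does-⇔ (mk⇔
      (λ eq → trans (cong (q ℕ.* r ℕ.+_) eq) (sym (ℕ.*-distribʳ-+ r q k)))
      (λ eq → ℕ.+-cancelˡ-≡ (q ℕ.* r) y (k ℕ.* r) (trans eq (ℕ.*-distribʳ-+ r q k))))
      (y ℕ.≟ k ℕ.* r) (q ℕ.* r ℕ.+ y ℕ.≟ (q ℕ.+ k) ℕ.* r)))
  cases (inj₂ d<q) = trans (shift-< f d<q) (sym (𝟙-no (q ℕ.* r ℕ.+ y ℕ.≟ d ℕ.* r)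
    λ eq → ℕ.<⇒≢ (ℕ.<-≤-trans (ℕ.*-monoˡ-< r d<q) (ℕ.m≤m+n (q ℕ.* r) y)) (sym eq)))

-- The degree d r part of `binomials-conjugate`. Degrees add under factorisation, so the two degree
-- tests combine into one. Where the weight of u is nonzero, r divides every exponent of u and hence
-- `deg u`, as `degree-convolution` requires.
squareFree-convolution : ∀ r .{{_ : NonZero r}} d m →
  ∑ₛ splitℕ d (λ a b → (squareFree 1ℚ a r ✶ squareFree -1ℚ b r) m) ≡
  𝟙 (does (deg m ℕ.≟ d ℕ.* r)) ⊗ binomials -1ℚ (2 ℕ.* r) m
squareFree-convolution r d m = begin
  ∑ₛ splitℕ d (λ a b → ∑ₛ S m λ u v → δ u a ⊗ w⁺ u ⊗ (δ v b ⊗ w⁻ v))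
    ≡⟨ ∑-swap (splitℕ d) (S m) _ ⟩
  ∑ₛ S m (λ u v → ∑ₛ splitℕ d λ a b → δ u a ⊗ w⁺ u ⊗ (δ v b ⊗ w⁻ v))
    ≡⟨ (∑ₛ-cong S m λ u v → ∑ₛ-cong splitℕ d λ a b → ⊗-interchange (δ u a) (w⁺ u) _ _) ⟩
  ∑ₛ S m (λ u v → ∑ₛ splitℕ d λ a b → δ u a ⊗ δ v b ⊗ (w⁺ u ⊗ w⁻ v))
    ≡⟨ (∑ₛ-cong S m λ u v → ∑-⊗ʳ (w⁺ u ⊗ w⁻ v) (splitℕ d) _) ⟨
  ∑ₛ S m (λ u v → ∑ₛ splitℕ d (λ a b → δ u a ⊗ δ v b) ⊗ (w⁺ u ⊗ w⁻ v))
    ≡⟨ ∑-cong∈ (S m) (λ {(u , v)} i → step u v (degreeFrom-Factors 0 (∈-factorisations⁻ {m} {u} {v} i))) ⟩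
  ∑ₛ S m (λ u v → δ m d ⊗ (w⁺ u ⊗ w⁻ v))
    ≡⟨ ∑-⊗ˡ (δ m d) (S m) _ ⟨
  δ m d ⊗ (w⁺ ✶ w⁻) m
    ≡⟨ ⊗-congˡ (binomials-conjugate r m) ⟩
  δ m d ⊗ binomials -1ℚ (2 ℕ.* r) m ∎
  where
  S = factorisations
  w⁺ = binomials 1ℚ r
  w⁻ = binomials -1ℚ r
  δ : Monomial → ℕ → ℚ
  δ u a = 𝟙 (does (deg u ℕ.≟ a ℕ.* r))
  step : ∀ u v → deg u ℕ.+ deg v ≡ deg m →
    ∑ₛ splitℕ d (λ a b → δ u a ⊗ δ v b) ⊗ (w⁺ u ⊗ w⁻ v) ≡ δ m d ⊗ (w⁺ u ⊗ w⁻ v)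
  step u v eq with binomials-∣ 1ℚ r u
  ... | inj₁ p = ⊗-congʳ (trans (degree-convolution r d (deg v) (∣degreeFrom 0 p))
    (cong (λ x → 𝟙 (does (x ℕ.≟ d ℕ.* r))) eq))
  ... | inj₂ z = trans (vanish _) (sym (vanish _))
    where
    vanish : ∀ x → x ⊗ (w⁺ u ⊗ w⁻ v) ≡ 0ℚ
    vanish x = trans (⊗-congˡ (trans (⊗-congʳ z) (⊗-zeroˡ (w⁻ v)))) (⊗-zeroʳ x)

-- The commutative monoid of series

✶-cong : ∀ {F F′ G G′} → F ≈ F′ → G ≈ G′ → F ✶ G ≈ F′ ✶ G′
✶-cong p q m = ∑ₛ-cong factorisations m λ u v → cong₂ _⊗_ (p u) (q v)

✶-comm : ∀ F G → F ✶ G ≈ G ✶ F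
✶-comm F G m = trans
  (splitList-cocommutative (splitList-cocommutative splitℕ-cocommutative) m _)
  (∑ₛ-cong factorisations m λ u v → ⊗-comm (F v) (G u))

✶-assoc : ∀ F G H → (F ✶ G) ✶ H ≈ F ✶ (G ✶ H)
✶-assoc F G H m = begin
  ∑ₛ S m (λ u v → (F ✶ G) u ⊗ H v)
    ≡⟨ (∑ₛ-cong S m λ u v → ∑-⊗ʳ (H v) (S u) _) ⟩
  ∑ₛ S m (λ u v → ∑ₛ S u λ w x → F w ⊗ G x ⊗ H v)
    ≡⟨ splitList-coassociative (splitList-coassociative splitℕ-coassociative) m _ ⟩
  ∑ₛ S m (λ u v → ∑ₛ S v λ w x → F u ⊗ G w ⊗ H x)
    ≡⟨ (∑ₛ-cong S m λ u v → trans (∑ₛ-cong S v λ w x → ⊗-assoc (F u) (G w) (H x))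
         (sym (∑-⊗ˡ (F u) (S v) _))) ⟩
  ∑ₛ S m (λ u v → F u ⊗ (G ✶ H) v) ∎
  where S = factorisations

if-∏ : {P : A → Set} (P? : ∀ x → Dec (P x)) {f : A → ℚ} → (∀ x → f x ≡ 𝟙 (does (P? x))) →
  ∀ xs → ∏ f xs ≡ 𝟙 (does (all? P? xs))
if-∏ P? eq []       = refl
if-∏ P? eq (x ∷ xs) = trans (cong₂ _⊗_ (eq x) (if-∏ P? eq xs))
  (trans (if-⊗ (does (P? x)) (does (all? P? xs)))
    (cong (if does (P? x) ∧ does (all? P? xs) then_else 0ℚ) (⊗-identityˡ 1ℚ)))

one-∏ : one ≈ ∏ (∏ λ e → 𝟙 (does (e ℕ.≟ 0)))
one-∏ m = sym (if-∏ (all? (ℕ._≟ 0)) (if-∏ (ℕ._≟ 0) λ _ → refl) m)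

✶-identityˡ : ∀ F → one ✶ F ≈ F
✶-identityˡ F m = trans (∑ₛ-cong factorisations m λ u v → ⊗-congʳ (one-∏ u))
  (splitList-counit (splitList-counit splitℕ-counit) m F)

✶-swapˡ : ∀ F G H → F ✶ (G ✶ H) ≈ G ✶ (F ✶ H)
✶-swapˡ F G H m = begin
  (F ✶ (G ✶ H)) m  ≡⟨ ✶-assoc F G H m ⟨
  (F ✶ G ✶ H) m    ≡⟨ ✶-cong {G = H} (✶-comm F G) (λ _ → refl) m ⟩
  (G ✶ F ✶ H) m    ≡⟨ ✶-assoc G F H m ⟩
  (G ✶ (F ✶ H)) m  ∎

∑-✶-∑ : (xs : List A) (ys : List B) (F : A → Series) (G : B → Series) →
  ((λ m → ∑ᵒ xs λ x → F x m) ✶ (λ m → ∑ᵒ ys λ y → G y m)) ≈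
  λ m → ∑ᵒ xs λ x → ∑ᵒ ys λ y → (F x ✶ G y) m
∑-✶-∑ xs ys F G m = begin
  ∑ₛ S m (λ u v → ∑ᵒ xs (λ x → F x u) ⊗ ∑ᵒ ys (λ y → G y v))
    ≡⟨ (∑ₛ-cong S m λ u v → ∑-⊗-∑ xs ys _ _) ⟩
  ∑ₛ S m (λ u v → ∑ᵒ xs λ x → ∑ᵒ ys λ y → F x u ⊗ G y v)
    ≡⟨ ∑-swap (S m) xs _ ⟩
  ∑ᵒ xs (λ x → ∑ₛ S m λ u v → ∑ᵒ ys λ y → F x u ⊗ G y v)
    ≡⟨ (∑-cong xs λ x → ∑-swap (S m) ys _) ⟩
  ∑ᵒ xs (λ x → ∑ᵒ ys λ y → (F x ✶ G y) m) ∎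
  where S = factorisations

⊗-✶-⊗ : ∀ p q F G → ((λ m → p ⊗ F m) ✶ (λ m → q ⊗ G m)) ≈ λ m → p ⊗ q ⊗ (F ✶ G) m
⊗-✶-⊗ p q F G m = trans
  (∑ₛ-cong factorisations m λ u v → ⊗-interchange p (F u) q (G v))
  (sym (∑-⊗ˡ (p ⊗ q) (factorisations m) _))

productOf : (A → Series) → List A → Series
productOf F = foldr (λ x G → F x ✶ G) one

productOf-++ : (F : A → Series) → ∀ xs ys → productOf F (xs ++ ys) ≈ productOf F xs ✶ productOf F ys
productOf-++ F []       ys m = sym (✶-identityˡ (productOf F ys) m)
productOf-++ F (x ∷ xs) ys m = trans
  (✶-cong {F x} (λ _ → refl) (productOf-++ F xs ys) m)
  (sym (✶-assoc (F x) (productOf F xs) (productOf F ys) m))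

productOf-↭ : (F : A → Series) → ∀ {xs ys} → xs ↭ ys → productOf F xs ≈ productOf F ys
productOf-↭ F _↭_.refl          m = refl
productOf-↭ F (_↭_.prep x p)    m = ✶-cong {F x} (λ _ → refl) (productOf-↭ F p) m
productOf-↭ F (_↭_.swap {xs} x y p) m = trans (✶-swapˡ (F x) (F y) (productOf F xs) m)
  (✶-cong {F y} (λ _ → refl) (✶-cong {F x} (λ _ → refl) (productOf-↭ F p)) m)
productOf-↭ F (_↭_.trans p q)   m = trans (productOf-↭ F p m) (productOf-↭ F q m)

productOf-cong : {F G : A → Series} → (∀ x → F x ≈ G x) → ∀ xs → productOf F xs ≈ productOf G xs
productOf-cong eq []       m = refl
productOf-cong eq (x ∷ xs) m = ✶-cong (eq x) (productOf-cong eq xs) m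

-- Signed products over blocks

squareFreeAt : ℚ → Block → Series
squareFreeAt c (block d r) = squareFree c d r

opaque
  unfolding _⊕_ _⊗_

  foldr-· : (F : A → Series) → ∀ xs → foldr (λ x G → F x · G) one xs ≈ productOf F xs
  foldr-· F []       m = refl
  foldr-· F (x ∷ xs) m = ✶-cong {F x} (λ _ → refl) (foldr-· F xs) m

  sign-suc : ∀ k → sign (suc k) ≡ -1ℚ ⊗ sign k
  sign-suc k = refl

E⁺-productOf : ∀ {n} (τ : Typ n) → E⁺ τ ≈ productOf (squareFreeAt 1ℚ) (blocks τ)
E⁺-productOf τ m = trans (foldr-· (atBlock E⁺-deg) (blocks τ) m)
  (productOf-cong (λ (block d r) → substPower-squareFree {s = λ _ → 1ℚ} refl (λ _ → sym (⊗-identityˡ 1ℚ)) d r)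
    (blocks τ) m)

E-productOf : ∀ {n} (τ : Typ n) → E τ ≈ productOf (squareFreeAt -1ℚ) (blocks τ)
E-productOf τ m = trans (foldr-· (atBlock E-deg) (blocks τ) m)
  (productOf-cong (λ (block d r) → substPower-squareFree {s = sign} refl sign-suc d r)
    (blocks τ) m)

-- The contribution of one tiling with content `Bs`: each brick brings one factor -1 from its
-- geometric series, which adds up to the sign (-1)^ℓ(τ) of the theorem.
signedE⁺ : List Block → Series
signedE⁺ Bs m = sign (length Bs) ⊗ productOf (squareFreeAt 1ℚ) Bs m

sign-+ : ∀ j k → sign (j ℕ.+ k) ≡ sign j ⊗ sign k
sign-+ = s-+ refl sign-suc

signedE⁺-++ : ∀ Bs Cs → signedE⁺ (Bs ++ Cs) ≈ signedE⁺ Bs ✶ signedE⁺ Cs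
signedE⁺-++ Bs Cs m = begin
  sign (length (Bs ++ Cs)) ⊗ productOf (squareFreeAt 1ℚ) (Bs ++ Cs) m
    ≡⟨ cong₂ _⊗_ (trans (cong sign (length-++ Bs)) (sign-+ (length Bs) (length Cs)))
         (productOf-++ (squareFreeAt 1ℚ) Bs Cs m) ⟩
  _ ≡⟨ ⊗-✶-⊗ (sign (length Bs)) (sign (length Cs)) _ _ m ⟨
  (signedE⁺ Bs ✶ signedE⁺ Cs) m ∎

signedE⁺-∷ : ∀ B Bs m → signedE⁺ (B ∷ Bs) m ≡ -1ℚ ⊗ (squareFreeAt 1ℚ B ✶ signedE⁺ Bs) m
signedE⁺-∷ B Bs m = begin
  sign (suc (length Bs)) ⊗ (squareFreeAt 1ℚ B ✶ P) m
    ≡⟨ ⊗-congʳ (sign-suc (length Bs)) ⟩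
  -1ℚ ⊗ sign (length Bs) ⊗ (squareFreeAt 1ℚ B ✶ P) m
    ≡⟨ ⊗-assoc -1ℚ _ _ ⟩
  -1ℚ ⊗ (sign (length Bs) ⊗ (squareFreeAt 1ℚ B ✶ P) m)
    ≡⟨ ⊗-congˡ (∑-⊗ˡ (sign (length Bs)) (factorisations m) _) ⟩
  -1ℚ ⊗ ∑ₛ factorisations m (λ u v → sign (length Bs) ⊗ (squareFreeAt 1ℚ B u ⊗ P v))
    ≡⟨ ⊗-congˡ (∑ₛ-cong factorisations m λ u v → ⊗-swapˡ (sign (length Bs)) (squareFreeAt 1ℚ B u) (P v)) ⟩
  -1ℚ ⊗ (squareFreeAt 1ℚ B ✶ signedE⁺ Bs) m ∎
  where P = productOf (squareFreeAt 1ℚ) Bs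

-- The expansion over the tilings of one row

-- Tilings of a row of L cells, in units of 2 ^ k, by bricks of marking at least k:
-- either the first brick has marking k, or all bricks have a larger marking
-- and the row is retiled in units of 2 ^ (k + 1).  The first argument bounds
-- the recursion depth; L suffices.
rowTilings : ℕ → ℕ → ℕ → List (List Brick)
coarserTilings : ∀ {L} → ℕ → ℕ → Dec (2 ∣ L) → List (List Brick)

rowTilings f       k zero    = [] ∷ []
rowTilings zero    k (suc L) = []
rowTilings (suc f) k (suc L) =
  concat (map (λ (a , b) → map (brick k (suc a) ∷_) (rowTilings f k b)) (splitℕ L)) ++
  coarserTilings f k (2 ∣? suc L)

coarserTilings f k (yes (divides h _)) = rowTilings f (suc k) h
coarserTilings f k (no _)              = []

∑-concat-map : (h : A → List B) (xs : List A) (f : B → ℚ) →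
  ∑ᵒ (concat (map h xs)) f ≡ ∑ᵒ xs λ x → ∑ᵒ (h x) f
∑-concat-map h []       f = refl
∑-concat-map h (x ∷ xs) f = trans (∑-++ (h x) _ f) (⊕-congˡ (∑-concat-map h xs f))

sum≡0 : ∀ {es} → All (_≡ 0) es → sum es ≡ 0
sum≡0 []          = refl
sum≡0 (refl ∷ ps) = sum≡0 ps

degreeFrom≡0 : ∀ i {m} → All (All (_≡ 0)) m → degreeFrom i m ≡ 0
degreeFrom≡0 i [] = refl
degreeFrom≡0 i (p ∷ ps) rewrite sum≡0 p | ℕ.*-zeroʳ i = degreeFrom≡0 (suc i) ps

sum≡0⁻ : ∀ es → sum es ≡ 0 → All (_≡ 0) es
sum≡0⁻ []       eq = []
sum≡0⁻ (e ∷ es) eq = ℕ.m+n≡0⇒m≡0 e eq ∷ sum≡0⁻ es (ℕ.m+n≡0⇒n≡0 e eq)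

degreeFrom≡0⁻ : ∀ i m → degreeFrom i m ≡ 0 → All (All (_≡ 0)) m
degreeFrom≡0⁻ i []       eq = []
degreeFrom≡0⁻ i (es ∷ m) eq =
  sum≡0⁻ es (ℕ.m+n≡0⇒m≡0 (sum es) (ℕ.m+n≡0⇒m≡0 (suc i ℕ.* sum es) eq)) ∷
  degreeFrom≡0⁻ (suc i) m (ℕ.m+n≡0⇒n≡0 (suc i ℕ.* sum es) eq)

∏≡1 : {P : A → Set} {f : A → ℚ} → (∀ {x} → P x → f x ≡ 1ℚ) → ∀ {xs} → All P xs → ∏ f xs ≡ 1ℚ
∏≡1 eq []       = refl
∏≡1 eq (p ∷ ps) = trans (cong₂ _⊗_ (eq p) (∏≡1 eq ps)) (⊗-identityˡ 1ℚ)

-- Degree 0 forces all exponents to vanish, and there every weight is 1. This accounts both for the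
-- empty row and for the term a = 0 of `squareFree-convolution`.
squareFree-zero : ∀ c r → squareFree c 0 r ≈ one
squareFree-zero c r m with all? (all? (ℕ._≟ 0)) m
... | yes p = trans (cong₂ _⊗_ (𝟙-yes (deg m ℕ.≟ 0) (degreeFrom≡0 0 p)) (∏≡1 (∏≡1 λ { refl → refl }) p))
  (⊗-identityˡ 1ℚ)
... | no ¬p = trans (⊗-congʳ (𝟙-no (deg m ℕ.≟ 0) (¬p ∘ degreeFrom≡0⁻ 0 m))) (⊗-zeroˡ _)

x⊕y≡z⇒x≡-y⊕z : ∀ {x y z} → x ⊕ y ≡ z → x ≡ -1ℚ ⊗ y ⊕ z
x⊕y≡z⇒x≡-y⊕z {x} {y} refl = sym (begin
  -1ℚ ⊗ y ⊕ (x ⊕ y)    ≡⟨ ⊕-swapˡ _ x y ⟩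
  x ⊕ (-1ℚ ⊗ y ⊕ y)    ≡⟨ ⊕-congˡ (⊕-congˡ (⊗-identityˡ y)) ⟨
  x ⊕ (-1ℚ ⊗ y ⊕ 1ℚ ⊗ y) ≡⟨ ⊕-congˡ (⊗-distribʳ-⊕ y -1ℚ 1ℚ) ⟨
  x ⊕ (-1ℚ ⊕ 1ℚ) ⊗ y   ≡⟨ ⊕-congˡ (trans (⊗-congʳ (⊕-inverseˡ 1ℚ)) (⊗-zeroˡ y)) ⟩
  x ⊕ 0ℚ               ≡⟨ ⊕-identityʳ x ⟩
  x                    ∎)

-- The geometric series in recursive form: the term a = 0 of `squareFree-convolution` is isolated,
-- since its first factor is `one`. The sum lets a first brick of suc a units be chosen; the last
-- term leaves the row to coarser bricks.
squareFree-suc : ∀ r .{{_ : NonZero r}} L m → squareFree -1ℚ (suc L) r m ≡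
  -1ℚ ⊗ ∑ₛ splitℕ L (λ a b → (squareFree 1ℚ (suc a) r ✶ squareFree -1ℚ b r) m) ⊕
  𝟙 (does (deg m ℕ.≟ suc L ℕ.* r)) ⊗ binomials -1ℚ (2 ℕ.* r) m
squareFree-suc r L m = x⊕y≡z⇒x≡-y⊕z (begin
  squareFree -1ℚ (suc L) r m ⊕ rest
    ≡⟨ ⊕-congʳ (trans (✶-cong {G = squareFree -1ℚ (suc L) r} (squareFree-zero 1ℚ r) (λ _ → refl) m)
         (✶-identityˡ _ m)) ⟨
  (squareFree 1ℚ 0 r ✶ squareFree -1ℚ (suc L) r) m ⊕ rest
    ≡⟨ ∑ₛ-sucˡ L _ ⟨
  ∑ₛ splitℕ (suc L) (λ a b → (squareFree 1ℚ a r ✶ squareFree -1ℚ b r) m)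
    ≡⟨ squareFree-convolution r (suc L) m ⟩
  _ ∎)
  where rest = ∑ₛ splitℕ L (λ a b → (squareFree 1ℚ (suc a) r ✶ squareFree -1ℚ b r) m)

module _ (i : ℕ) where

  private
    scale : ℕ → ℕ
    scale k = 2 ^ k ℕ.* suc i

    instance
      scale≢0 : ∀ {k} → NonZero (scale k)
      scale≢0 {k} = ℕ.m*n≢0 (2 ^ k) (suc i) {{ℕ.m^n≢0 2 k}}

    term : List Brick → Series
    term bs = signedE⁺ (map (brickBlock i) bs)

  -- Both sides obey the same recursion, `squareFree-suc` on the left and the definition of
  -- `rowTilings` on the right. The factor -1 of the first brick is absorbed by `signedE⁺-∷`.
  squareFree-rowTilings : ∀ f k L → L ℕ.≤ f →
    squareFree -1ℚ L (scale k) ≈ λ m → ∑ᵒ (rowTilings f k L) λ bs → term bs m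
  -- The weights live on exponents divisible by `2 * scale k`, hence so do the degrees. For even suc
  -- L = 2h the left side is `squareFree -1ℚ h` at the doubled unit; for odd suc L it vanishes, like
  -- the sum over the empty list.
  squareFree-coarserTilings : ∀ f k L → L ℕ.≤ f → (2∣? : Dec (2 ∣ suc L)) → ∀ m →
    𝟙 (does (deg m ℕ.≟ suc L ℕ.* scale k)) ⊗ binomials -1ℚ (2 ℕ.* scale k) m ≡
    ∑ᵒ (coarserTilings f k 2∣?) λ bs → term bs m

  squareFree-rowTilings f k zero L≤f m = trans (squareFree-zero -1ℚ (scale k) m)
    (sym (trans (⊕-identityʳ _) (⊗-identityˡ (one m))))
  squareFree-rowTilings (suc f) k (suc L) (ℕ.s≤s L≤f) m = begin
    squareFree -1ℚ (suc L) (scale k) m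
      ≡⟨ squareFree-suc (scale k) {{scale≢0 {k}}} L m ⟩
    _ ≡⟨ cong₂ _⊕_ (trans (∑-⊗ˡ -1ℚ (splitℕ L) _)
           (∑-cong∈ (splitℕ L) λ {(a , b)} ab∈ → first a b
             (ℕ.≤-trans (ℕ.m+n≤o⇒n≤o a (ℕ.≤-reflexive (∈-splitℕ⁻ ab∈))) L≤f)))
           (squareFree-coarserTilings f k L L≤f (2 ∣? suc L) m) ⟩
    _ ≡⟨ ⊕-congʳ (∑-concat-map starting (splitℕ L) _) ⟨
    _ ≡⟨ ∑-++ (concat (map starting (splitℕ L))) _ _ ⟨
    ∑ᵒ (rowTilings (suc f) k (suc L)) (λ bs → term bs m) ∎
    where
    starting : ℕ × ℕ → List (List Brick)
    starting (a , b) = map (brick k (suc a) ∷_) (rowTilings f k b)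
    first : ∀ a b → b ℕ.≤ f →
      -1ℚ ⊗ (squareFree 1ℚ (suc a) (scale k) ✶ squareFree -1ℚ b (scale k)) m ≡
      ∑ᵒ (map (brick k (suc a) ∷_) (rowTilings f k b)) (λ bs → term bs m)
    first a b b≤f = begin
      -1ℚ ⊗ (F ✶ squareFree -1ℚ b (scale k)) m
        ≡⟨ ⊗-congˡ (✶-cong {F} (λ _ → refl) (squareFree-rowTilings f k b b≤f) m) ⟩
      -1ℚ ⊗ (F ✶ (λ m → ∑ᵒ T λ bs → term bs m)) m
        ≡⟨ ⊗-congˡ (trans (∑ₛ-cong factorisations m λ u v → ∑-⊗ˡ (F u) T _)
             (∑-swap (factorisations m) T _)) ⟩
      -1ℚ ⊗ ∑ᵒ T (λ bs → (F ✶ term bs) m)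
        ≡⟨ ∑-⊗ˡ -1ℚ T _ ⟩
      ∑ᵒ T (λ bs → -1ℚ ⊗ (F ✶ term bs) m)
        ≡⟨ (∑-cong T λ bs → signedE⁺-∷ (brickBlock i (brick k (suc a))) (map (brickBlock i) bs) m) ⟨
      ∑ᵒ T (λ bs → term (brick k (suc a) ∷ bs) m)
        ≡⟨ ∑-map (brick k (suc a) ∷_) T _ ⟨
      _ ∎
      where
      F = squareFree 1ℚ (suc a) (scale k)
      T = rowTilings f k b

  squareFree-coarserTilings f k L L≤f (yes (divides h eq)) m = begin
    𝟙 (does (deg m ℕ.≟ suc L ℕ.* scale k)) ⊗ binomials -1ℚ (2 ℕ.* scale k) m
      ≡⟨ cong (λ x → 𝟙 (does (deg m ℕ.≟ x)) ⊗ binomials -1ℚ (2 ℕ.* scale k) m)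
           (trans (cong (ℕ._* scale k) eq) (ℕ.*-assoc h 2 (scale k))) ⟩
    squareFree -1ℚ h (2 ℕ.* scale k) m
      ≡⟨ cong (λ x → squareFree -1ℚ h x m) (ℕ.*-assoc 2 (2 ^ k) (suc i)) ⟨
    squareFree -1ℚ h (scale (suc k)) m
      ≡⟨ squareFree-rowTilings f (suc k) h (ℕ.≤-trans (h≤L h eq) L≤f) m ⟩
    _ ∎
    where
    h≤L : ∀ h → suc L ≡ h ℕ.* 2 → h ℕ.≤ L
    h≤L (suc h) refl = ℕ.s≤s (ℕ.m≤m*n h 2)
  squareFree-coarserTilings f k L L≤f (no 2∤) m with binomials-∣ -1ℚ (2 ℕ.* scale k) m
  ... | inj₂ z = trans (⊗-congˡ z) (⊗-zeroʳ _)
  ... | inj₁ p with divides q eq ← ∣degreeFrom 0 p =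
    trans (⊗-congʳ (𝟙-no (deg m ℕ.≟ suc L ℕ.* scale k) λ eq′ → contradiction
      (divides q (ℕ.*-cancelʳ-≡ (suc L) (q ℕ.* 2) (scale k) {{scale≢0 {k}}}
        (trans (sym eq′) (trans eq (sym (ℕ.*-assoc q 2 (scale k))))))) 2∤)) (⊗-zeroˡ _)

-- Types as multisets of blocks

private
  ≥-decTotalOrder : DecTotalOrder _ _ _
  ≥-decTotalOrder = Flip.decTotalOrder ℕ.≤-decTotalOrder

open Sort ≥-decTotalOrder using (sort; sort-↭; sort-↗)

partition-≡ : ∀ {p q} → parts p ≡ parts q → p ≡ q
partition-≡ {mkPartition _ _ _} {mkPartition _ _ _} refl = refl

parts-↭⇒≡ : ∀ {p q} → parts p ↭ parts q → p ≡ q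
parts-↭⇒≡ {p} {q} eq = partition-≡ (≋⇒≡
  (Sorted.↗↭↗⇒≋ (DecTotalOrder.totalOrder ≥-decTotalOrder) (sorted p) (sorted q) (↭⇒↭ₛ eq)))
  where
  sorted : ∀ p → Linked ℕ._≥_ (parts p)
  -- The order of the parts is an irrelevant field; decidability recovers a proof that may be used
  -- here.
  sorted (mkPartition ds _ dec) = recompute (linked? ℕ._≥?_ ds) dec

_≟ᵀ_ : ∀ {n} → DecidableEquality (Typ n)
mkTyp ps _ ≟ᵀ mkTyp qs _ = map′ (λ { refl → refl }) (cong factors)
  (Vec.≡-dec (λ p q → map′ partition-≡ (cong parts) (List.≡-dec ℕ._≟_ (parts p) (parts q))) ps qs)

HasMultiplicity : ℕ → Block → Set
HasMultiplicity r B = multiplicity B ≡ r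

hasMultiplicity? : ∀ r → Decidable (HasMultiplicity r)
hasMultiplicity? r B = multiplicity B ℕ.≟ r

blocksOf : ℕ → List ℕ → List Block
blocksOf i = map λ d → block d (suc i)

blocksFrom-multiplicity : ∀ {k} i (ps : Vec Partition k) → All (λ B → i ℕ.< multiplicity B) (blocksFrom i ps)
blocksFrom-multiplicity i []       = []
blocksFrom-multiplicity i (p ∷ ps) = All.++⁺
  (All.map⁺ (All.universal (λ _ → ℕ.≤-refl) (parts p)))
  (All.map (ℕ.≤-trans (ℕ.n≤1+n (suc i))) (blocksFrom-multiplicity (suc i) ps))

module _ (i : ℕ) {k} (p : Partition) (ps : Vec Partition k) where

  private
    later : All (¬_ ∘ HasMultiplicity (suc i)) (blocksFrom (suc i) ps)
    later = All.map ℕ.>⇒≢ (blocksFrom-multiplicity (suc i) ps)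
    now : All (HasMultiplicity (suc i)) (blocksOf i (parts p))
    now = All.map⁺ (All.universal (λ _ → refl) (parts p))

  filter-blocksFrom : filter (hasMultiplicity? (suc i)) (blocksFrom i (p ∷ ps)) ≡ blocksOf i (parts p)
  filter-blocksFrom = trans (filter-++ P? (blocksOf i (parts p)) _)
    (trans (cong₂ _++_ (filter-all P? now) (filter-none P? later)) (++-identityʳ _))
    where P? = hasMultiplicity? (suc i)

  filter-¬-blocksFrom : filter (¬? ∘ hasMultiplicity? (suc i)) (blocksFrom i (p ∷ ps)) ≡ blocksFrom (suc i) ps
  filter-¬-blocksFrom = trans (filter-++ P? (blocksOf i (parts p)) _)
    (cong₂ _++_ (filter-none P? (All.map (λ eq ¬eq → ¬eq eq) now)) (filter-all P? later))
    where P? = ¬? ∘ hasMultiplicity? (suc i)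

degree-blocksOf : ∀ i ds → map degree (blocksOf i ds) ≡ ds
degree-blocksOf i ds = trans (sym (map-∘ ds)) (map-id ds)

-- The tail only yields multiplicities above suc i. Filtering by multiplicity suc i thus recovers
-- the parts of the head, up to order, and the complementary filter recovers the tail.
blocksFrom-injective : ∀ {k} i (ps qs : Vec Partition k) → blocksFrom i ps ↭ blocksFrom i qs → ps ≡ qs
blocksFrom-injective i []       []       _  = refl
blocksFrom-injective i (p ∷ ps) (q ∷ qs) eq = cong₂ _∷_
  (parts-↭⇒≡ (subst₂ _↭_ (degree-blocksOf i (parts p)) (degree-blocksOf i (parts q))
    (Perm.map⁺ degree (subst₂ _↭_ (filter-blocksFrom i p ps) (filter-blocksFrom i q qs)
      (filter-↭ (hasMultiplicity? (suc i)) eq)))))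
  (blocksFrom-injective (suc i) ps qs
    (subst₂ _↭_ (filter-¬-blocksFrom i p ps) (filter-¬-blocksFrom i q qs)
      (filter-↭ (¬? ∘ hasMultiplicity? (suc i)) eq)))

blocks-injective : ∀ {n} {σ τ : Typ n} → blocks σ ↭ blocks τ → σ ≡ τ
blocks-injective {σ = mkTyp ps _} {mkTyp qs _} eq with refl ← blocksFrom-injective 0 ps qs eq = refl

filter-++-filter-¬ : {P : A → Set} (P? : Decidable P) → ∀ xs → filter P? xs ++ filter (¬? ∘ P?) xs ↭ xs
filter-++-filter-¬ P? []       = ↭-refl
filter-++-filter-¬ P? (x ∷ xs) with P? x
... | yes _ = Perm.prep x (filter-++-filter-¬ P? xs)
... | no  _ = ↭-trans (Perm.shift x (filter P? xs) _) (Perm.prep x (filter-++-filter-¬ P? xs))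

HasDegree : Block → Set
HasDegree B = NonZero (degree B)

module _ (i : ℕ) where

  partitionAt : (Bs : List Block) → .(All HasDegree Bs) → Partition
  partitionAt Bs nz = mkPartition (sort ds)
    (All-resp-↭ (↭-sym (sort-↭ ds)) (All.map⁺ (All.filter⁺ (hasMultiplicity? (suc i)) nz)))
    (sort-↗ ds)
    where ds = map degree (filter (hasMultiplicity? (suc i)) Bs)

  blocksOf-degree : ∀ {Bs} → All (HasMultiplicity (suc i)) Bs → blocksOf i (map degree Bs) ≡ Bs
  blocksOf-degree []                          = refl
  blocksOf-degree {block d _ ∷ _} (refl ∷ ps) = cong (block d (suc i) ∷_) (blocksOf-degree ps)

  blocksOf-partitionAt : ∀ Bs .nz →
    blocksOf i (parts (partitionAt Bs nz)) ↭ filter (hasMultiplicity? (suc i)) Bs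
  blocksOf-partitionAt Bs nz = ↭-trans (Perm.map⁺ _ (sort-↭ _))
    (↭-reflexive (blocksOf-degree (All.all-filter (hasMultiplicity? (suc i)) Bs)))

factorsOf : ∀ k → ℕ → (Bs : List Block) → .(All HasDegree Bs) → Vec Partition k
factorsOf zero    i Bs nz = []
factorsOf (suc k) i Bs nz = partitionAt i Bs nz ∷
  factorsOf k (suc i) (filter (¬? ∘ hasMultiplicity? (suc i)) Bs)
    (All.filter⁺ (¬? ∘ hasMultiplicity? (suc i)) nz)

-- The bounds ensure that nothing is left over. Removing multiplicity suc i raises the lower bound
-- and keeps the upper one, and for k = 0 the interval is empty.
blocksFrom-factorsOf : ∀ k i Bs .nz → All (λ B → i ℕ.< multiplicity B × multiplicity B ℕ.≤ i ℕ.+ k) Bs →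
  blocksFrom i (factorsOf k i Bs nz) ↭ Bs
blocksFrom-factorsOf zero    i []      nz [] = ↭-refl
blocksFrom-factorsOf zero    i (B ∷ _) nz ((i<m , m≤i) ∷ _) =
  contradiction (ℕ.<-≤-trans i<m m≤i) (ℕ.<-irrefl (sym (ℕ.+-identityʳ i)))
blocksFrom-factorsOf (suc k) i Bs nz bounds = ↭-trans
  (Perm.++⁺ (blocksOf-partitionAt i Bs nz)
    (blocksFrom-factorsOf k (suc i) _ _ (All.zipWith
      (λ ((i<m , m≤i) , m≢i) → ℕ.≤∧≢⇒< i<m (m≢i ∘ sym) ,
        ℕ.≤-trans m≤i (ℕ.≤-reflexive (ℕ.+-suc i k)))
      (All.filter⁺ P? bounds , All.all-filter P? Bs))))
  (filter-++-filter-¬ (hasMultiplicity? (suc i)) Bs)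
  where P? = ¬? ∘ hasMultiplicity? (suc i)

blockWeight : Block → ℕ
blockWeight B = multiplicity B ℕ.* degree B

totalWeight : List Block → ℕ
totalWeight Bs = sum (map blockWeight Bs)

totalWeight-++ : ∀ Bs Cs → totalWeight (Bs ++ Cs) ≡ totalWeight Bs ℕ.+ totalWeight Cs
totalWeight-++ Bs Cs = trans (cong sum (map-++ blockWeight Bs Cs)) (sum-++ (map blockWeight Bs) _)

totalWeight-blocksOf : ∀ i ds → totalWeight (blocksOf i ds) ≡ suc i ℕ.* sum ds
totalWeight-blocksOf i []       = sym (ℕ.*-zeroʳ (suc i))
totalWeight-blocksOf i (d ∷ ds) = trans (cong (suc i ℕ.* d ℕ.+_) (totalWeight-blocksOf i ds))
  (sym (ℕ.*-distribˡ-+ (suc i) d (sum ds)))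

weightFrom-blocksFrom : ∀ {k} i (ps : Vec Partition k) → weightFrom i ps ≡ totalWeight (blocksFrom i ps)
weightFrom-blocksFrom i []       = refl
weightFrom-blocksFrom i (p ∷ ps) = sym (trans (totalWeight-++ (blocksOf i (parts p)) _)
  (cong₂ ℕ._+_ (totalWeight-blocksOf i (parts p)) (sym (weightFrom-blocksFrom (suc i) ps))))

totalWeight-↭ : ∀ {Bs Cs} → Bs ↭ Cs → totalWeight Bs ≡ totalWeight Cs
totalWeight-↭ eq = sum-↭ (Perm.map⁺ blockWeight eq)

-- A block of nonzero degree weighs at least its multiplicity. So n factors are enough to hold any
-- multiset of blocks of total weight n.
multiplicity-bounds : ∀ {Bs} → All HasDegree Bs →
  All (λ B → 0 ℕ.< multiplicity B × multiplicity B ℕ.≤ totalWeight Bs) Bs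
multiplicity-bounds []                      = []
multiplicity-bounds {block d r ∷ Bs} (nz ∷ nzs) =
  (ℕ.>-nonZero⁻¹ r , ℕ.≤-trans (ℕ.m≤m*n r d {{nz}}) (ℕ.m≤m+n (r ℕ.* d) _)) ∷
  All.map (λ (lo , hi) → lo , ℕ.≤-trans hi (ℕ.m≤n+m _ (r ℕ.* d))) (multiplicity-bounds nzs)

module _ {n} (Bs : List Block) (nz : All HasDegree Bs) (w : totalWeight Bs ≡ n) where

  private
    factors-↭ : blocksFrom 0 (factorsOf n 0 Bs nz) ↭ Bs
    factors-↭ = blocksFrom-factorsOf n 0 Bs nz
      (subst (λ n → All (λ B → 0 ℕ.< multiplicity B × multiplicity B ℕ.≤ n) Bs) w (multiplicity-bounds nz))

  typeOf : Typ n
  typeOf = mkTyp (factorsOf n 0 Bs nz)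
    (trans (weightFrom-blocksFrom 0 (factorsOf n 0 Bs nz)) (trans (totalWeight-↭ factors-↭) w))

  blocks-typeOf : blocks typeOf ↭ Bs
  blocks-typeOf = factors-↭

ℓ-blocks : ∀ {n} (τ : Typ n) → ℓ τ ≡ length (blocks τ)
ℓ-blocks τ = go 0 (factors τ)
  where
  go : ∀ {k} i (ps : Vec Partition k) → Vec.sum (Vec.map (length ∘ parts) ps) ≡ length (blocksFrom i ps)
  go i []       = refl
  go i (p ∷ ps) = sym (trans (length-++ (blocksOf i (parts p)))
    (cong₂ ℕ._+_ (length-map _ (parts p)) (sym (go (suc i) ps))))

-- Correctness of the enumeration of row tilings

tilingLength : List Brick → ℕ
tilingLength bs = sum (map brickLength bs)

-- Specifies the members of `rowTilings f k L` for large enough f. As L counts units of 2^k, the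
-- case k = 0 is the condition in `RowTiling L`.
record IsTiling (k L : ℕ) (bs : List Brick) : Set where
  constructor isTiling
  field
    coarse  : All (λ b → k ℕ.≤ marking b) bs
    ordered : AllPairs (ℕ._≤_ on marking) bs
    fills   : tilingLength bs ≡ 2 ^ k ℕ.* L

startingWith : ℕ → ℕ → ℕ × ℕ → List (List Brick)
startingWith f k (a , b) = map (brick k (suc a) ∷_) (rowTilings f k b)

∈-startingWith⁻ : ∀ f k ab {bs} → bs ∈ startingWith f k ab →
  ∃[ bs′ ] bs′ ∈ rowTilings f k (proj₂ ab) × bs ≡ brick k (suc (proj₁ ab)) ∷ bs′
∈-startingWith⁻ f k ab = ∈-map⁻ _

∈-starting⁻ : ∀ f k L {bs} → bs ∈ concat (map (startingWith f k) (splitℕ L)) →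
  ∃[ a ] ∃[ b ] ∃[ bs′ ] a ℕ.+ b ≡ L × bs′ ∈ rowTilings f k b × bs ≡ brick k (suc a) ∷ bs′
∈-starting⁻ f k L i with ∈-concat⁻′ (map (startingWith f k) (splitℕ L)) i
... | _ , j , l with ∈-map⁻ _ l
...   | (a , b) , ab∈ , refl with ∈-startingWith⁻ f k (a , b) j
...     | bs′ , p , eq = a , b , bs′ , ∈-splitℕ⁻ ab∈ , p , eq

2^suc : ∀ k h → 2 ^ suc k ℕ.* h ≡ 2 ^ k ℕ.* (h ℕ.* 2)
2^suc k h = lemma (2 ^ k) h
  where
  lemma : ∀ x h → 2 ℕ.* x ℕ.* h ≡ x ℕ.* (h ℕ.* 2)
  lemma = solve-∀

rowTilings-sound : ∀ f k L {bs} → bs ∈ rowTilings f k L → IsTiling k L bs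
-- The sharper bound on markings is stated separately because it tells the two halves of
-- `rowTilings` apart in `rowTilings-unique`.
coarserTilings-sound : ∀ f k L (2∣? : Dec (2 ∣ L)) {bs} → bs ∈ coarserTilings f k 2∣? →
  All (λ b → suc k ℕ.≤ marking b) bs × IsTiling k L bs

rowTilings-sound f k zero (here refl) = isTiling [] [] (sym (ℕ.*-zeroʳ (2 ^ k)))
rowTilings-sound (suc f) k (suc L) i with ∈-++⁻ (concat (map (startingWith f k) (splitℕ L))) i
... | inj₂ j = proj₂ (coarserTilings-sound f k (suc L) (2 ∣? suc L) j)
... | inj₁ j with ∈-starting⁻ f k L j
...   | a , b , bs , refl , p , refl with rowTilings-sound f k b p
...     | isTiling coarse ordered fills = isTiling (ℕ.≤-refl ∷ coarse) (coarse ∷ ordered)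
  (trans (cong (2 ^ k ℕ.* suc a ℕ.+_) fills) (sym (ℕ.*-distribˡ-+ (2 ^ k) (suc a) b)))

coarserTilings-sound f k L (yes (divides h refl)) i with rowTilings-sound f (suc k) h i
... | isTiling coarse ordered fills =
  coarse , isTiling (All.map ℕ.<⇒≤ coarse) ordered (trans fills (2^suc k h))

2^∣brickLength : ∀ {k} b → k ℕ.≤ marking b → 2 ^ k ∣ brickLength b
2^∣brickLength {k} b k≤ with j , eq ← ℕ.m≤n⇒∃[o]m+o≡n k≤ =
  divides (2 ^ j ℕ.* Brick.quotient b) (begin
    2 ^ marking b ℕ.* Brick.quotient b      ≡⟨ cong (λ x → 2 ^ x ℕ.* Brick.quotient b) eq ⟨
    2 ^ (k ℕ.+ j) ℕ.* Brick.quotient b      ≡⟨ cong (ℕ._* Brick.quotient b) (ℕ.^-distribˡ-+-* 2 k j) ⟩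
    2 ^ k ℕ.* 2 ^ j ℕ.* Brick.quotient b    ≡⟨ lemma (2 ^ k) (2 ^ j) (Brick.quotient b) ⟩
    2 ^ j ℕ.* Brick.quotient b ℕ.* 2 ^ k    ∎)
  where
  lemma : ∀ x y q → x ℕ.* y ℕ.* q ≡ y ℕ.* q ℕ.* x
  lemma = solve-∀

2^∣tilingLength : ∀ {k bs} → All (λ b → k ℕ.≤ marking b) bs → 2 ^ k ∣ tilingLength bs
2^∣tilingLength []                = _ ∣0
2^∣tilingLength {bs = b ∷ _} (p ∷ ps) = ∣m∣n⇒∣m+n (2^∣brickLength b p) (2^∣tilingLength ps)

-- The first brick decides the half: if its marking exceeds k, then by the ordering all markings do.
rowTilings-complete : ∀ f k L {bs} → L ℕ.≤ f → IsTiling k L bs → bs ∈ rowTilings f k L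
-- Bricks of marking above k have lengths divisible by 2^(k+1), and so does the row, which excludes
-- an odd number of units of 2^k.
coarserTilings-complete : ∀ f k L (2∣? : Dec (2 ∣ suc L)) {bs} → L ℕ.≤ f →
  All (λ b → suc k ℕ.≤ marking b) bs → IsTiling k (suc L) bs → bs ∈ coarserTilings f k 2∣?

rowTilings-complete f k zero {[]} L≤f t = here refl
rowTilings-complete f k zero {brick κ (suc q) ∷ bs} L≤f (isTiling _ _ fills) = contradiction
  (ℕ.m+n≡0⇒m≡0 (2 ^ κ ℕ.* suc q) (trans fills (ℕ.*-zeroʳ (2 ^ k))))
  (ℕ.≢-nonZero⁻¹ (2 ^ κ ℕ.* suc q) {{ℕ.m*n≢0 (2 ^ κ) (suc q) {{ℕ.m^n≢0 2 κ}}}})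
rowTilings-complete (suc f) k (suc L) {[]} L≤f (isTiling _ _ fills) = contradiction
  (sym fills) (ℕ.≢-nonZero⁻¹ (2 ^ k ℕ.* suc L) {{ℕ.m*n≢0 (2 ^ k) (suc L) {{ℕ.m^n≢0 2 k}}}})
rowTilings-complete (suc f) k (suc L) {brick κ (suc a) ∷ bs} (ℕ.s≤s L≤f)
  t@(isTiling (k≤κ ∷ coarse) (κ≤ ∷ ordered) fills) with k ℕ.≟ κ
... | no k≢κ = ∈-++⁺ʳ (concat (map (startingWith f k) (splitℕ L)))
  (coarserTilings-complete f k L (2 ∣? suc L) L≤f
    (k<κ ∷ All.map (ℕ.≤-trans k<κ) κ≤) t)
  where k<κ = ℕ.≤∧≢⇒< k≤κ k≢κ
... | yes refl = ∈-++⁺ˡ (∈-concat⁺′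
  (∈-map⁺ (brick k (suc a) ∷_) (rowTilings-complete f k (L ℕ.∸ a)
    (ℕ.≤-trans (ℕ.m∸n≤m L a) L≤f) (isTiling coarse ordered rest)))
  (∈-map⁺ (startingWith f k) (∈-splitℕ⁺ (ℕ.m+[n∸m]≡n a≤L))))
  where
  instance 2^k≢0 = ℕ.m^n≢0 2 k
  a≤L : a ℕ.≤ L
  a≤L = ℕ.s≤s⁻¹ (ℕ.*-cancelˡ-≤ (2 ^ k) (ℕ.≤-trans (ℕ.m≤m+n _ _) (ℕ.≤-reflexive fills)))
  rest : tilingLength bs ≡ 2 ^ k ℕ.* (L ℕ.∸ a)
  rest = ℕ.+-cancelˡ-≡ (2 ^ k ℕ.* suc a) _ _ (trans fills (trans
    (cong (λ x → 2 ^ k ℕ.* suc x) (sym (ℕ.m+[n∸m]≡n a≤L)))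
    (ℕ.*-distribˡ-+ (2 ^ k) (suc a) (L ℕ.∸ a))))

coarserTilings-complete f k L (yes (divides h eq)) L≤f coarser (isTiling _ ordered fills) =
  rowTilings-complete f (suc k) h (ℕ.≤-trans (h≤L h eq) L≤f) (isTiling coarser ordered
    (trans fills (trans (cong (2 ^ k ℕ.*_) eq) (sym (2^suc k h)))))
  where
  h≤L : ∀ h → suc L ≡ h ℕ.* 2 → h ℕ.≤ L
  h≤L (suc h) refl = ℕ.s≤s (ℕ.m≤m*n h 2)
coarserTilings-complete f k L (no 2∤) L≤f coarser (isTiling _ _ fills)
  with divides q eq ← 2^∣tilingLength coarser = contradiction
    (divides q (ℕ.*-cancelˡ-≡ (suc L) (q ℕ.* 2) (2 ^ k) {{ℕ.m^n≢0 2 k}}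
      (trans (sym fills) (trans eq (trans (ℕ.*-comm q (2 ^ suc k)) (2^suc k q)))))) 2∤

-- Within the first half the leading brick reveals a, hence the splitting of L; its marking k keeps
-- the tiling out of the coarser half.
rowTilings-unique : ∀ f k L → Unique (rowTilings f k L)
coarserTilings-unique : ∀ f k {L} (2∣? : Dec (2 ∣ L)) → Unique (coarserTilings f k 2∣?)

rowTilings-unique f       k zero    = [] ∷ []
rowTilings-unique zero    k (suc L) = []
rowTilings-unique (suc f) k (suc L) = Unique.++⁺
  (Unique.concat⁺
    (All.map⁺ (All.universal (λ (a , b) → Unique.map⁺ (λ { refl → refl }) (rowTilings-unique f k b)) (splitℕ L)))
    (AllPairs.map⁺ (AllPairs.map⁺ (AllPairs.map
      (λ {a} {a′} a≢a′ {_} (i , j) → a≢a′ (heads (a , L ℕ.∸ a) (a′ , L ℕ.∸ a′) i j))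
      (Unique.upTo⁺ (suc L))))))
  (coarserTilings-unique f k (2 ∣? suc L))
  λ {_} (i , j) → finest i (coarserTilings-sound f k (suc L) (2 ∣? suc L) j)
  where
  heads : ∀ ab cd {bs} → bs ∈ startingWith f k ab → bs ∈ startingWith f k cd → proj₁ ab ≡ proj₁ cd
  heads ab cd i j with ∈-startingWith⁻ f k ab i | ∈-startingWith⁻ f k cd j
  ... | _ , _ , refl | _ , _ , refl = refl
  finest : ∀ {bs} {T : Set} → bs ∈ concat (map (startingWith f k) (splitℕ L)) →
    ¬ (All (λ b → suc k ℕ.≤ marking b) bs × T)
  finest i (coarser , _) with ∈-starting⁻ f k L i
  finest i (k<k ∷ _ , _) | _ , _ , _ , _ , _ , refl = ℕ.<-irrefl refl k<k

coarserTilings-unique f k (yes (divides h _)) = rowTilings-unique f (suc k) h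
coarserTilings-unique f k (no _)              = []

bricks-injective : ∀ {L} {t u : RowTiling L} → bricks t ≡ bricks u → t ≡ u
bricks-injective {t = mkRowTiling _ _ _} {mkRowTiling _ _ _} refl = refl

-- The attached laws are irrelevant, so distinctness and completeness carry over from the lists of
-- bricks.
allRowTilings : ∀ L → List (RowTiling L)
allRowTilings L = mapWith∈ (rowTilings L 0 L) λ {bs} i → mkRowTiling bs
  (IsTiling.ordered (rowTilings-sound L 0 L i))
  (trans (IsTiling.fills (rowTilings-sound L 0 L i)) (ℕ.+-identityʳ L))

bricks-allRowTilings : ∀ L → map bricks (allRowTilings L) ≡ rowTilings L 0 L
bricks-allRowTilings L = trans (map-mapWith∈ (rowTilings L 0 L) _ bricks) (mapWith∈-id _)

allRowTilings-unique : ∀ L → Unique (allRowTilings L)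
allRowTilings-unique L = Unique.map⁻ (subst Unique (sym (bricks-allRowTilings L)) (rowTilings-unique L 0 L))

allRowTilings-complete : ∀ {L} (t : RowTiling L) → t ∈ allRowTilings L
allRowTilings-complete {L} t@(mkRowTiling bs ordered fills) with ∈-map⁻ bricks
  (subst (bs ∈_) (sym (bricks-allRowTilings L)) (rowTilings-complete L 0 L ℕ.≤-refl (isTiling
    (All.universal (λ _ → ℕ.z≤n) bs)
    (recompute (AllPairs.allPairs? (λ b c → marking b ℕ.≤? marking c) bs) ordered)
    (trans (recompute (_ ℕ.≟ _) fills) (sym (ℕ.+-identityʳ L))))))
... | u , i , eq = subst (_∈ allRowTilings L) (sym (bricks-injective eq)) i

squareFree-allRowTilings : ∀ i d → squareFree -1ℚ d (suc i) ≈
  λ m → ∑ᵒ (allRowTilings d) λ t → signedE⁺ (map (brickBlock i) (bricks t)) m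
squareFree-allRowTilings i d m = begin
  squareFree -1ℚ d (suc i) m
    ≡⟨ cong (λ r → squareFree -1ℚ d r m) (ℕ.+-identityʳ (suc i)) ⟨
  squareFree -1ℚ d (2 ^ 0 ℕ.* suc i) m
    ≡⟨ squareFree-rowTilings i d 0 d ℕ.≤-refl m ⟩
  ∑ᵒ (rowTilings d 0 d) (λ bs → signedE⁺ (map (brickBlock i) bs) m)
    ≡⟨ cong (λ ts → ∑ᵒ ts λ bs → signedE⁺ (map (brickBlock i) bs) m) (bricks-allRowTilings d) ⟨
  ∑ᵒ (map bricks (allRowTilings d)) (λ bs → signedE⁺ (map (brickBlock i) bs) m)
    ≡⟨ ∑-map bricks (allRowTilings d) _ ⟩
  _ ∎

-- Tilings of tensor diagrams

module _ {P : A → Set} (choices : ∀ x → List (P x)) where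

  allAlls : ∀ xs → List (All P xs)
  allAlls []       = [] ∷ []
  allAlls (x ∷ xs) = cartesianProductWith _∷_ (choices x) (allAlls xs)

  allVecAlls : ∀ {n} (xs : Vec A n) → List (VecAll.All P xs)
  allVecAlls []       = [] ∷ []
  allVecAlls (x ∷ xs) = cartesianProductWith _∷_ (choices x) (allVecAlls xs)

  module _ (unique : ∀ x → Unique (choices x)) where

    allAlls-unique : ∀ xs → Unique (allAlls xs)
    allAlls-unique []       = [] ∷ []
    allAlls-unique (x ∷ xs) = Unique.cartesianProductWith⁺ _∷_ (λ { refl → refl , refl })
      (unique x) (allAlls-unique xs)

    allVecAlls-unique : ∀ {n} (xs : Vec A n) → Unique (allVecAlls xs)
    allVecAlls-unique []       = [] ∷ []
    allVecAlls-unique (x ∷ xs) = Unique.cartesianProductWith⁺ _∷_ (λ { refl → refl , refl })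
      (unique x) (allVecAlls-unique xs)

  module _ (complete : ∀ {x} (p : P x) → p ∈ choices x) where

    allAlls-complete : ∀ {xs} (ps : All P xs) → ps ∈ allAlls xs
    allAlls-complete []       = here refl
    allAlls-complete (p ∷ ps) = ∈-cartesianProductWith⁺ _∷_ (complete p) (allAlls-complete ps)

    allVecAlls-complete : ∀ {n} {xs : Vec A n} (ps : VecAll.All P xs) → ps ∈ allVecAlls xs
    allVecAlls-complete []       = here refl
    allVecAlls-complete (p ∷ ps) = ∈-cartesianProductWith⁺ _∷_ (complete p) (allVecAlls-complete ps)

allFactorTilings : ∀ p → List (FactorTiling p)
allFactorTilings p = allAlls allRowTilings (parts p)

allTilings : ∀ {k} (ps : Vec Partition k) → List (VecAll.All FactorTiling ps)
allTilings = allVecAlls allFactorTilings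

allTilings-unique : ∀ {k} (ps : Vec Partition k) → Unique (allTilings ps)
allTilings-unique = allVecAlls-unique allFactorTilings λ p → allAlls-unique allRowTilings allRowTilings-unique (parts p)

allTilings-complete : ∀ {k} {ps : Vec Partition k} (ts : VecAll.All FactorTiling ps) → ts ∈ allTilings ps
allTilings-complete = allVecAlls-complete allFactorTilings (allAlls-complete allRowTilings allRowTilings-complete)

-- Distributivity for sums over tilings. It is kept abstract in `h` and `content` because it serves
-- twice: for joining a row to a factor, and a factor to a diagram.
∑-signedE⁺-++ : (h : A → B → C) (content : C → List Block) (f : A → List Block) (g : B → List Block) →
  (∀ a b → content (h a b) ≡ f a ++ g b) → ∀ xs ys →
  ((λ m → ∑ᵒ xs λ x → signedE⁺ (f x) m) ✶ (λ m → ∑ᵒ ys λ y → signedE⁺ (g y) m)) ≈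
  λ m → ∑ᵒ (cartesianProductWith h xs ys) λ z → signedE⁺ (content z) m
∑-signedE⁺-++ h content f g eq xs ys m = begin
  _ ≡⟨ ∑-✶-∑ xs ys (signedE⁺ ∘ f) (signedE⁺ ∘ g) m ⟩
  ∑ᵒ xs (λ x → ∑ᵒ ys λ y → (signedE⁺ (f x) ✶ signedE⁺ (g y)) m)
    ≡⟨ (∑-cong xs λ x → ∑-cong ys λ y → signedE⁺-++ (f x) (g y) m) ⟨
  ∑ᵒ xs (λ x → ∑ᵒ ys λ y → signedE⁺ (f x ++ g y) m)
    ≡⟨ (∑-cong xs λ x → ∑-cong ys λ y → cong (λ Bs → signedE⁺ Bs m) (eq x y)) ⟨
  ∑ᵒ xs (λ x → ∑ᵒ ys λ y → signedE⁺ (content (h x y)) m)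
    ≡⟨ ∑-cartesianProductWith h xs ys _ ⟨
  _ ∎

productOf-factor : ∀ i ds → productOf (squareFreeAt -1ℚ) (blocksOf i ds) ≈
  λ m → ∑ᵒ (allAlls allRowTilings ds) λ ts → signedE⁺ (factorContent i ts) m
productOf-factor i []       m = sym (trans (⊕-identityʳ _) (⊗-identityˡ (one m)))
productOf-factor i (d ∷ ds) m = trans
  (✶-cong (squareFree-allRowTilings i d) (productOf-factor i ds) m)
  (∑-signedE⁺-++ _∷_ (factorContent i) (map (brickBlock i) ∘ bricks) (factorContent i)
    (λ _ _ → refl) (allRowTilings d) (allAlls allRowTilings ds) m)

productOf-blocksFrom : ∀ {k} i (ps : Vec Partition k) → productOf (squareFreeAt -1ℚ) (blocksFrom i ps) ≈
  λ m → ∑ᵒ (allTilings ps) λ ts → signedE⁺ (contentFrom i ts) m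
productOf-blocksFrom i []       m = sym (trans (⊕-identityʳ _) (⊗-identityˡ (one m)))
productOf-blocksFrom i (p ∷ ps) m = trans
  (productOf-++ (squareFreeAt -1ℚ) (blocksOf i (parts p)) (blocksFrom (suc i) ps) m) (trans
  (✶-cong (productOf-factor i (parts p)) (productOf-blocksFrom (suc i) ps) m)
  (∑-signedE⁺-++ _∷_ (contentFrom i) (factorContent i) (contentFrom (suc i))
    (λ _ _ → refl) (allFactorTilings p) (allTilings ps) m))

E-expansion : ∀ {n} (σ : Typ n) → E σ ≈ λ m → ∑ᵒ (allTilings (factors σ)) λ ts → signedE⁺ (contentFrom 0 ts) m
E-expansion σ m = trans (E-productOf σ m) (productOf-blocksFrom 0 (factors σ) m)

-- A brick of 2^k q cells in tensor factor i + 1 turns into a block of weight 2^k (i + 1) q. Weight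
-- is preserved, so the content of a tiling of a type of n is again a type of n.
totalWeight-bricks : ∀ i bs → totalWeight (map (brickBlock i) bs) ≡ suc i ℕ.* tilingLength bs
totalWeight-bricks i []               = sym (ℕ.*-zeroʳ (suc i))
totalWeight-bricks i (brick k q ∷ bs) = trans
  (cong (2 ^ k ℕ.* suc i ℕ.* q ℕ.+_) (totalWeight-bricks i bs))
  (lemma (2 ^ k) (suc i) q (tilingLength bs))
  where
  lemma : ∀ x i q t → x ℕ.* i ℕ.* q ℕ.+ i ℕ.* t ≡ i ℕ.* (x ℕ.* q ℕ.+ t)
  lemma = solve-∀

totalWeight-factorContent : ∀ i {ds} (ts : All RowTiling ds) → totalWeight (factorContent i ts) ≡ suc i ℕ.* sum ds
totalWeight-factorContent i []                        = sym (ℕ.*-zeroʳ (suc i))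
totalWeight-factorContent i {d ∷ ds} (mkRowTiling bs _ fills ∷ ts) = begin
  totalWeight (map (brickBlock i) bs ++ factorContent i ts)
    ≡⟨ totalWeight-++ (map (brickBlock i) bs) _ ⟩
  totalWeight (map (brickBlock i) bs) ℕ.+ totalWeight (factorContent i ts)
    ≡⟨ cong₂ ℕ._+_ (trans (totalWeight-bricks i bs) (cong (suc i ℕ.*_) (recompute (_ ℕ.≟ _) fills)))
         (totalWeight-factorContent i ts) ⟩
  suc i ℕ.* d ℕ.+ suc i ℕ.* sum ds
    ≡⟨ ℕ.*-distribˡ-+ (suc i) d (sum ds) ⟨
  suc i ℕ.* sum (d ∷ ds) ∎

totalWeight-contentFrom : ∀ {k} i {ps : Vec Partition k} (ts : VecAll.All FactorTiling ps) →
  totalWeight (contentFrom i ts) ≡ weightFrom i ps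
totalWeight-contentFrom i []       = refl
totalWeight-contentFrom i (t ∷ ts) = trans (totalWeight-++ (factorContent i t) _)
  (cong₂ ℕ._+_ (totalWeight-factorContent i t) (totalWeight-contentFrom (suc i) ts))

hasDegree-bricks : ∀ i bs → All HasDegree (map (brickBlock i) bs)
hasDegree-bricks i bs = All.map⁺ (All.universal (λ (brick k q {{nz}}) → recompute (ℕ.nonZero? q) nz) bs)

hasDegree-factorContent : ∀ i {ds} (ts : All RowTiling ds) → All HasDegree (factorContent i ts)
hasDegree-factorContent i []       = []
hasDegree-factorContent i (t ∷ ts) = All.++⁺ (hasDegree-bricks i (bricks t)) (hasDegree-factorContent i ts)

hasDegree-contentFrom : ∀ {k} i {ps : Vec Partition k} (ts : VecAll.All FactorTiling ps) →
  All HasDegree (contentFrom i ts)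
hasDegree-contentFrom i []       = []
hasDegree-contentFrom i (t ∷ ts) = All.++⁺ (hasDegree-factorContent i t) (hasDegree-contentFrom (suc i) ts)

-- Collecting tilings by content

lookup-injective : {xs : List A} → Unique xs → ∀ {i j} → lookup xs i ≡ lookup xs j → i ≡ j
lookup-injective (x∉ ∷ u) {zero}  {zero}  eq = refl
lookup-injective (x∉ ∷ u) {zero}  {suc j} eq = contradiction eq (All.lookup x∉ (∈-lookup j))
lookup-injective (x∉ ∷ u) {suc i} {zero}  eq = contradiction (sym eq) (All.lookup x∉ (∈-lookup i))
lookup-injective (x∉ ∷ u) {suc i} {suc j} eq = cong suc (lookup-injective u eq)

∑-δ : (_≟_ : DecidableEquality A) (g : A → ℚ) → ∀ {xs x} → Unique xs → x ∈ xs →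
  ∑ᵒ xs (λ y → 𝟙 (does (x ≟ y)) ⊗ g y) ≡ g x
∑-δ _≟_ g {_ ∷ xs} {x} (x∉ ∷ u) (here refl) = trans
  (cong₂ _⊕_ (trans (⊗-congʳ (𝟙-yes (x ≟ x) refl)) (⊗-identityˡ (g x)))
    (trans (∑-cong∈ xs λ {y} y∈ → trans (⊗-congʳ (𝟙-no (x ≟ y) (All.lookup x∉ y∈))) (⊗-zeroˡ (g y)))
      (∑-zero xs)))
  (⊕-identityʳ (g x))
∑-δ _≟_ g {y ∷ xs} {x} (y∉ ∷ u) (there x∈) = trans
  (cong₂ _⊕_ (trans (⊗-congʳ (𝟙-no (x ≟ y) (All.lookup y∉ x∈ ∘ sym))) (⊗-zeroˡ (g y)))
    (∑-δ _≟_ g u x∈))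
  (⊕-identityˡ (g x))

opaque
  unfolding _⊕_ _⊗_

  -- The gcd inside `+ n / 1` does not compute for a variable n; `normalize-coprime` puts an
  -- explicit fraction in its place, on which addition does.
  fromℕ-suc : ∀ n → + suc n / 1 ≡ 1ℚ ⊕ + n / 1
  fromℕ-suc n = sym (trans
    (cong (1ℚ ℚ.+_) (ℚ.normalize-coprime {n} {0} (Coprimality.sym (Coprimality.1-coprimeTo n))))
    (cong (_/ 1) (cong (λ x → + 1 ℤ.+ x) (ℤ.*-identityʳ (+ n)))))

  ∑-∑ᵒ : (xs : List A) (c f : A → ℚ) → ∑ xs (λ x → c x * f x) ≡ ∑ᵒ xs λ x → c x ⊗ f x
  ∑-∑ᵒ xs c f = refl

  *-⊗ : ∀ x y → x * y ≡ x ⊗ y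
  *-⊗ x y = refl

∑-one : (xs : List A) → ∑ᵒ xs (λ _ → 1ℚ) ≡ + length xs / 1
∑-one []       = refl
∑-one (x ∷ xs) = trans (⊕-congˡ (∑-one xs)) (sym (fromℕ-suc (length xs)))

weight-factors : ∀ {n} (τ : Typ n) → weightFrom 0 (factors τ) ≡ n
weight-factors (mkTyp _ w) = recompute (_ ℕ.≟ _) w

module _ {n} (σ : Typ n) where

  Tilings : Set
  Tilings = VecAll.All FactorTiling (factors σ)

  contentType : Tilings → Typ n
  contentType ts = typeOf (contentFrom 0 ts) (hasDegree-contentFrom 0 ts)
    (trans (totalWeight-contentFrom 0 ts) (weight-factors σ))

  blocks-contentType : ∀ ts → blocks (contentType ts) ↭ contentFrom 0 ts
  blocks-contentType ts = blocks-typeOf (contentFrom 0 ts) (hasDegree-contentFrom 0 ts)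
    (trans (totalWeight-contentFrom 0 ts) (weight-factors σ))

  tilingsOfType : Typ n → List Tilings
  tilingsOfType τ = filter (λ ts → contentType ts ≟ᵀ τ) (allTilings (factors σ))

  PTdyad↔Fin : ∀ τ → PTdyad σ τ ↔ Fin (length (tilingsOfType τ))
  PTdyad↔Fin τ = mk↔ₛ′ to from to∘from from∘to
    where
    hasType? = λ ts → contentType ts ≟ᵀ τ
    tilings∈ : (t : PTdyad σ τ) → PTdyad.tilings t ∈ tilingsOfType τ
    tilings∈ (mkPTdyad ts content) = ∈-filter⁺ hasType? (allTilings-complete ts)
      -- The content proof is irrelevant, but membership in the filtered list needs a relevant one;
      -- the decidable equality of types supplies it.
      (recompute (hasType? ts) (blocks-injective (↭-trans (blocks-contentType ts) content)))
    to : PTdyad σ τ → Fin (length (tilingsOfType τ))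
    to t = index (tilings∈ t)
    from : Fin (length (tilingsOfType τ)) → PTdyad σ τ
    from i = mkPTdyad (lookup (tilingsOfType τ) i)
      (↭-trans (↭-sym (blocks-contentType (lookup (tilingsOfType τ) i)))
        (Perm.↭-reflexive (cong blocks
          (proj₂ (∈-filter⁻ hasType? {xs = allTilings (factors σ)} (∈-lookup i))))))
    from∘to : ∀ t → from (to t) ≡ t
    from∘to t = tilings-injective (sym (lookup-index (tilings∈ t)))
      where
      tilings-injective : ∀ {t u : PTdyad σ τ} → PTdyad.tilings t ≡ PTdyad.tilings u → t ≡ u
      tilings-injective {mkPTdyad _ _} {mkPTdyad _ _} refl = refl
    to∘from : ∀ i → to (from i) ≡ i
    to∘from i = lookup-injective (Unique.filter⁺ hasType? (allTilings-unique (factors σ)))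
      (sym (lookup-index (tilings∈ (from i))))

  coefficient : Typ n → ℚ
  coefficient τ = sign (ℓ τ) * (+ length (tilingsOfType τ) / 1)

  contentTypes : List (Typ n)
  contentTypes = deduplicate _≟ᵀ_ (map contentType (allTilings (factors σ)))

  coefficient-vanishing : ∀ τ → τ ∉ contentTypes → coefficient τ ≡ 0ℚ
  coefficient-vanishing τ τ∉ = trans
    (cong (λ ts → sign (ℓ τ) * (+ length ts / 1)) (filter-none (λ ts → contentType ts ≟ᵀ τ)
      (All.tabulate λ {ts} ts∈ eq → τ∉ (∈-deduplicate⁺ _≟ᵀ_ (subst (_∈ _) eq (∈-map⁺ contentType ts∈))))))
    (ℚ.*-zeroʳ (sign (ℓ τ)))

  signedE⁺-contentType : ∀ ts m → signedE⁺ (contentFrom 0 ts) m ≡ sign (ℓ (contentType ts)) ⊗ E⁺ (contentType ts) m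
  signedE⁺-contentType ts m = cong₂ _⊗_
    (cong sign (trans (sym (↭-length (blocks-contentType ts))) (sym (ℓ-blocks (contentType ts)))))
    (trans (productOf-↭ (squareFreeAt 1ℚ) (↭-sym (blocks-contentType ts)) m)
      (sym (E⁺-productOf (contentType ts) m)))

  E-coefficients : E σ ≈ λ m → ∑ contentTypes λ τ → coefficient τ * E⁺ τ m
  E-coefficients m = begin
    E σ m
      ≡⟨ E-expansion σ m ⟩
    ∑ᵒ T (λ ts → signedE⁺ (contentFrom 0 ts) m)
      ≡⟨ (∑-cong T λ ts → signedE⁺-contentType ts m) ⟩
    ∑ᵒ T (λ ts → g (contentType ts))
      -- Inserting the indicator of the content of `ts` allows the sums to be exchanged, which
      -- groups the tilings by content.
      ≡⟨ ∑-cong∈ T (λ {ts} ts∈ → ∑-δ _≟ᵀ_ g (deduplicate-! _≟ᵀ_ _)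
           (∈-deduplicate⁺ _≟ᵀ_ (∈-map⁺ contentType ts∈))) ⟨
    ∑ᵒ T (λ ts → ∑ᵒ contentTypes λ τ → 𝟙 (does (contentType ts ≟ᵀ τ)) ⊗ g τ)
      ≡⟨ ∑-swap T contentTypes _ ⟩
    ∑ᵒ contentTypes (λ τ → ∑ᵒ T λ ts → 𝟙 (does (contentType ts ≟ᵀ τ)) ⊗ g τ)
      ≡⟨ (∑-cong contentTypes λ τ → collect τ) ⟩
    ∑ᵒ contentTypes (λ τ → coefficient τ ⊗ E⁺ τ m)
      ≡⟨ ∑-∑ᵒ contentTypes coefficient (λ τ → E⁺ τ m) ⟨
    ∑ contentTypes (λ τ → coefficient τ * E⁺ τ m) ∎
    where
    T = allTilings (factors σ)
    g : Typ n → ℚ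
    g τ = sign (ℓ τ) ⊗ E⁺ τ m
    collect : ∀ τ → ∑ᵒ T (λ ts → 𝟙 (does (contentType ts ≟ᵀ τ)) ⊗ g τ) ≡ coefficient τ ⊗ E⁺ τ m
    collect τ = begin
      ∑ᵒ T (λ ts → 𝟙 (does (contentType ts ≟ᵀ τ)) ⊗ g τ)
        -- The extra factor 1 gives the sum the shape of `∑-filter`, which turns it into a count.
        ≡⟨ (∑-cong T λ ts → ⊗-congʳ (⊗-identityʳ _)) ⟨
      ∑ᵒ T (λ ts → 𝟙 (does (contentType ts ≟ᵀ τ)) ⊗ 1ℚ ⊗ g τ)
        ≡⟨ ∑-⊗ʳ (g τ) T _ ⟨
      ∑ᵒ T (λ ts → 𝟙 (does (contentType ts ≟ᵀ τ)) ⊗ 1ℚ) ⊗ g τ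
        ≡⟨ ⊗-congʳ (∑-filter (λ ts → contentType ts ≟ᵀ τ) T _) ⟨
      ∑ᵒ (tilingsOfType τ) (λ _ → 1ℚ) ⊗ g τ
        ≡⟨ ⊗-congʳ (∑-one (tilingsOfType τ)) ⟩
      + length (tilingsOfType τ) / 1 ⊗ g τ
        ≡⟨ ⊗-swapˡ _ _ _ ⟩
      sign (ℓ τ) ⊗ (+ length (tilingsOfType τ) / 1 ⊗ E⁺ τ m)
        ≡⟨ ⊗-assoc _ _ _ ⟨
      sign (ℓ τ) ⊗ (+ length (tilingsOfType τ) / 1) ⊗ E⁺ τ m
        ≡⟨ ⊗-congʳ (*-⊗ _ _) ⟨
      coefficient τ ⊗ E⁺ τ m ∎

  E-isExpansion : IsExpansion E⁺ (E σ) coefficient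
  E-isExpansion = record
    { support   = contentTypes
    ; distinct  = deduplicate-! _≟ᵀ_ _
    ; vanishing = coefficient-vanishing
    ; expands   = E-coefficients
    }

-- Monomials as multisets of blocks, and their rank

variableAt : ℕ → ℕ → List Block
variableAt i zero    = []
variableAt i (suc e) = block (suc i) (suc e) ∷ []

rowVariables : ℕ → List ℕ → List Block
rowVariables i []       = []
rowVariables i (e ∷ es) = variableAt i e ++ rowVariables i es

-- The monomial ∏ xᵢⱼ ^ eᵢⱼ is recorded as the multiset of the blocks i ^ eᵢⱼ with eᵢⱼ ≠ 0.
variablesFrom : ℕ → Monomial → List Block
variablesFrom i []       = []
variablesFrom i (es ∷ m) = rowVariables i es ++ variablesFrom (suc i) m

variables : Monomial → List Block
variables = variablesFrom 0

-- The rank is strictly subadditive when exponents of one variable are added, and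
-- strictly superadditive when degrees are added at a fixed multiplicity.
rank : Block → ℕ
rank (block d r) = d ℕ.* d ℕ.* r ℕ.+ 1

totalRank : List Block → ℕ
totalRank Bs = sum (map rank Bs)

-- A coarse substitute for the refinement order: when the multisets differ, only their ranks are
-- compared, which is all that the descent in `E⁺-independent` uses.
infix 4 _≼_
_≼_ : List Block → List Block → Set
Bs ≼ Cs = totalRank Bs ℕ.< totalRank Cs ⊎ Bs ↭ Cs

totalRank-↭ : ∀ {Bs Cs} → Bs ↭ Cs → totalRank Bs ≡ totalRank Cs
totalRank-↭ p = sum-↭ (Perm.map⁺ rank p)

totalRank-++ : ∀ Bs Cs → totalRank (Bs ++ Cs) ≡ totalRank Bs ℕ.+ totalRank Cs
totalRank-++ Bs Cs = trans (cong sum (map-++ rank Bs Cs)) (sum-++ (map rank Bs) _)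

≼⇒≤ : ∀ {Bs Cs} → Bs ≼ Cs → totalRank Bs ℕ.≤ totalRank Cs
≼⇒≤ (inj₁ lt) = ℕ.<⇒≤ lt
≼⇒≤ (inj₂ p)  = ℕ.≤-reflexive (totalRank-↭ p)

≼-trans : ∀ {Bs Cs Ds} → Bs ≼ Cs → Cs ≼ Ds → Bs ≼ Ds
≼-trans (inj₁ lt) q          = inj₁ (ℕ.<-≤-trans lt (≼⇒≤ q))
≼-trans p         (inj₁ lt)  = inj₁ (ℕ.≤-<-trans (≼⇒≤ p) lt)
≼-trans (inj₂ p)  (inj₂ q)   = inj₂ (↭-trans p q)

++-mono-≼ : ∀ {Bs Bs′ Cs Cs′} → Bs ≼ Bs′ → Cs ≼ Cs′ → Bs ++ Cs ≼ Bs′ ++ Cs′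
++-mono-≼ {Bs} {Bs′} {Cs} {Cs′} p q = combine p q
  where
  strict : totalRank Bs ℕ.+ totalRank Cs ℕ.< totalRank Bs′ ℕ.+ totalRank Cs′ → Bs ++ Cs ≼ Bs′ ++ Cs′
  strict lt = inj₁ (subst₂ ℕ._<_ (sym (totalRank-++ Bs Cs)) (sym (totalRank-++ Bs′ Cs′)) lt)
  combine : Bs ≼ Bs′ → Cs ≼ Cs′ → Bs ++ Cs ≼ Bs′ ++ Cs′
  combine (inj₁ lt) q         = strict (ℕ.+-mono-<-≤ lt (≼⇒≤ q))
  combine p         (inj₁ lt) = strict (ℕ.+-mono-≤-< (≼⇒≤ p) lt)
  combine (inj₂ p)  (inj₂ q)  = inj₂ (Perm.++⁺ p q)

++-interchange : (Bs Cs Ds Es : List Block) → (Bs ++ Cs) ++ (Ds ++ Es) ↭ (Bs ++ Ds) ++ (Cs ++ Es)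
++-interchange = CommutativeSemigroupProperties.interchange
  (CommutativeMonoid.commutativeSemigroup Perm.++-commutativeMonoid)

-- A variable occurring in both factors has two blocks there and one in the product. The terms
-- linear in the exponent agree, so the ranks differ by exactly the summand 1.
variableAt-≼ : ∀ i {e a b} → Sums e a b → variableAt i e ≼ variableAt i a ++ variableAt i b
variableAt-≼ i {a = zero}             refl = inj₂ ↭-refl
variableAt-≼ i {a = suc a} {b = zero} refl =
  inj₂ (↭-reflexive (cong (variableAt i) (ℕ.+-identityʳ (suc a))))
variableAt-≼ i {a = suc a} {b = suc b} refl = inj₁ (ℕ.≤-reflexive (lemma (suc i ℕ.* suc i) (suc a) (suc b)))
  where
  lemma : ∀ d x y → suc (d ℕ.* (x ℕ.+ y) ℕ.+ 1 ℕ.+ 0) ≡ d ℕ.* x ℕ.+ 1 ℕ.+ (d ℕ.* y ℕ.+ 1 ℕ.+ 0)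
  lemma = solve-∀

rowVariables-≼ : ∀ i {es as bs} → Zip Sums es as bs → rowVariables i es ≼ rowVariables i as ++ rowVariables i bs
rowVariables-≼ i [] = inj₂ ↭-refl
rowVariables-≼ i (_∷_ {_} {a} {b} {_} {as} {bs} p ps) = ≼-trans
  (++-mono-≼ (variableAt-≼ i {a = a} {b} p) (rowVariables-≼ i ps))
  (inj₂ (++-interchange (variableAt i a) (variableAt i b) (rowVariables i as) (rowVariables i bs)))

variablesFrom-≼ : ∀ i {m u v} → Factors m u v → variablesFrom i m ≼ variablesFrom i u ++ variablesFrom i v
variablesFrom-≼ i [] = inj₂ ↭-refl
variablesFrom-≼ i (_∷_ {_} {a} {b} {_} {u} {v} p ps) = ≼-trans
  (++-mono-≼ (rowVariables-≼ i p) (variablesFrom-≼ (suc i) ps))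
  (inj₂ (++-interchange (rowVariables i a) (rowVariables i b) (variablesFrom (suc i) u) (variablesFrom (suc i) v)))

-- The cross term 2 d e r is at least 2 and so exceeds the 1 lost with a block. The long summand in
-- `lemma` is the slack 2 d e r - 2, with all three variables shifted by one.
merge-≼ : ∀ d e r .{{_ : NonZero d}} .{{_ : NonZero e}} .{{_ : NonZero r}} →
  block d r ∷ block e r ∷ [] ≼ block (d ℕ.+ e) r ∷ []
merge-≼ (suc d) (suc e) (suc r) = inj₁ (ℕ.≤-trans (ℕ.m≤m+n _ _) (ℕ.≤-reflexive (lemma d e r)))
  where
  lemma : ∀ d e r →
    suc (suc d ℕ.* suc d ℕ.* suc r ℕ.+ 1 ℕ.+ (suc e ℕ.* suc e ℕ.* suc r ℕ.+ 1 ℕ.+ 0)) ℕ.+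
      (2 ℕ.* ((d ℕ.+ e ℕ.+ d ℕ.* e) ℕ.* suc r ℕ.+ r)) ≡
    (suc d ℕ.+ suc e) ℕ.* (suc d ℕ.+ suc e) ℕ.* suc r ℕ.+ 1 ℕ.+ 0
  lemma = solve-∀

sumDegrees : List Block → ℕ
sumDegrees Bs = sum (map degree Bs)

hasMultiplicity-≡ : ∀ r .{{_ : NonZero r}} {B} → HasMultiplicity r B → B ≡ block (degree B) r
hasMultiplicity-≡ r refl = refl

-- Blocks are merged from the end of the list. That the merged tail has nonzero degree is carried
-- along, as the next `merge-≼` requires it.
merge-all-≼ : ∀ r .{{_ : NonZero r}} B {Bs} → All (HasMultiplicity r) (B ∷ Bs) → All HasDegree (B ∷ Bs) →
  NonZero (sumDegrees (B ∷ Bs)) × (B ∷ Bs ≼ block (sumDegrees (B ∷ Bs)) r ∷ [])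
merge-all-≼ r B {[]} (m ∷ _) (nz ∷ _) rewrite ℕ.+-identityʳ (degree B) =
  nz , inj₂ (↭-reflexive (cong (_∷ []) (hasMultiplicity-≡ r m)))
merge-all-≼ r B {C ∷ Bs} (m ∷ ms) (nz ∷ nzs) with nz′ , p ← merge-all-≼ r C ms nzs =
  ℕ.>-nonZero (ℕ.≤-trans (ℕ.>-nonZero⁻¹ (degree B) {{nz}}) (ℕ.m≤m+n (degree B) _)) ,
  ≼-trans (++-mono-≼ (inj₂ (↭-reflexive (cong (_∷ []) (hasMultiplicity-≡ r m)))) p)
    (merge-≼ (degree B) (sumDegrees (C ∷ Bs)) r {{nz}} {{nz′}})

totalWeight-multiplicity : ∀ {r Bs} → All (HasMultiplicity r) Bs → totalWeight Bs ≡ r ℕ.* sumDegrees Bs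
totalWeight-multiplicity {r} []                            = sym (ℕ.*-zeroʳ r)
totalWeight-multiplicity {r} {block d _ ∷ Bs} (refl ∷ ms) = trans
  (cong (r ℕ.* d ℕ.+_) (totalWeight-multiplicity ms)) (sym (ℕ.*-distribˡ-+ r d (sumDegrees Bs)))

rowVariables-weight : ∀ i es → totalWeight (rowVariables i es) ≡ suc i ℕ.* sum es
rowVariables-weight i []           = sym (ℕ.*-zeroʳ (suc i))
rowVariables-weight i (zero ∷ es)  = rowVariables-weight i es
rowVariables-weight i (suc e ∷ es) = trans
  (cong₂ ℕ._+_ (ℕ.*-comm (suc e) (suc i)) (rowVariables-weight i es))
  (sym (ℕ.*-distribˡ-+ (suc i) (suc e) (sum es)))

variablesFrom-weight : ∀ i m → totalWeight (variablesFrom i m) ≡ degreeFrom i m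
variablesFrom-weight i []       = refl
variablesFrom-weight i (es ∷ m) = trans (totalWeight-++ (rowVariables i es) _)
  (cong₂ ℕ._+_ (rowVariables-weight i es) (variablesFrom-weight (suc i) m))

rowVariables-All : {P : ℕ → Set} {Q : Block → Set} → (∀ {i e} → P (suc e) → Q (block (suc i) (suc e))) →
  ∀ i {es} → All P es → All Q (rowVariables i es)
rowVariables-All q i []                   = []
rowVariables-All q i {zero ∷ _}  (_ ∷ ps) = rowVariables-All q i ps
rowVariables-All q i {suc _ ∷ _} (p ∷ ps) = q p ∷ rowVariables-All q i ps

variablesFrom-All : {P : ℕ → Set} {Q : Block → Set} → (∀ {i e} → P (suc e) → Q (block (suc i) (suc e))) →
  ∀ i {m} → All (All P) m → All Q (variablesFrom i m)
variablesFrom-All q i []       = []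
variablesFrom-All q i (p ∷ ps) = All.++⁺ (rowVariables-All q i p) (variablesFrom-All q (suc i) ps)

rowVariables-All⁻ : {P : ℕ → Set} {Q : Block → Set} → P 0 → (∀ {i e} → Q (block (suc i) (suc e)) → P (suc e)) →
  ∀ i es → All Q (rowVariables i es) → All P es
rowVariables-All⁻ p0 p i []           _        = []
rowVariables-All⁻ p0 p i (zero ∷ es)  qs       = p0 ∷ rowVariables-All⁻ p0 p i es qs
rowVariables-All⁻ p0 p i (suc e ∷ es) (q ∷ qs) = p q ∷ rowVariables-All⁻ p0 p i es qs

variablesFrom-All⁻ : {P : ℕ → Set} {Q : Block → Set} → P 0 → (∀ {i e} → Q (block (suc i) (suc e)) → P (suc e)) →
  ∀ i m → All Q (variablesFrom i m) → All (All P) m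
variablesFrom-All⁻ p0 p i []       _  = []
variablesFrom-All⁻ p0 p i (es ∷ m) qs =
  rowVariables-All⁻ p0 p i es (All.++⁻ˡ (rowVariables i es) qs) ∷
  variablesFrom-All⁻ p0 p (suc i) m (All.++⁻ʳ (rowVariables i es) qs)

hasDegree-variables : ∀ m → All HasDegree (variables m)
hasDegree-variables m = variablesFrom-All {P = λ _ → ⊤} (λ _ → _) 0
  (All.universal (λ es → All.universal (λ _ → tt) es) m)

wt-support : ∀ c r e → (e ≡ 0 ⊎ e ≡ r) ⊎ wt c r e ≡ 0ℚ
wt-support c r e with e ℕ.≟ 0
... | yes e≡0 = inj₁ (inj₁ e≡0)
... | no  e≢0 with e ℕ.≟ r
...   | yes e≡r = inj₁ (inj₂ e≡r)
...   | no  e≢r = inj₂ (wt-other r c e≢0 e≢r)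

-- On the support all exponents are 0 or r, so all variables have multiplicity r, and their degrees
-- add up to d. Merging them produces the single block.
squareFree-support : ∀ c d r .{{_ : NonZero d}} .{{_ : NonZero r}} m →
  variables m ≼ block d r ∷ [] ⊎ squareFree c d r m ≡ 0ℚ
squareFree-support c d r m with deg m ℕ.≟ d ℕ.* r | ∏-All (∏-All (wt-support c r)) m
... | _     | inj₂ z = inj₂ (trans (⊗-congˡ z) (⊗-zeroʳ _))
... | no ≢  | _      = inj₂ (trans (⊗-congʳ (𝟙-no (deg m ℕ.≟ d ℕ.* r) ≢)) (⊗-zeroˡ _))
... | yes eq | inj₁ p = inj₁ (bound (variables m) (variablesFrom-All (λ { (inj₂ e≡r) → e≡r }) 0 p)
  (hasDegree-variables m) (trans (variablesFrom-weight 0 m) eq))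
  where
  bound : ∀ Bs → All (HasMultiplicity r) Bs → All HasDegree Bs → totalWeight Bs ≡ d ℕ.* r → Bs ≼ block d r ∷ []
  bound [] _ _ w = contradiction (sym w) (ℕ.≢-nonZero⁻¹ (d ℕ.* r) {{ℕ.m*n≢0 d r}})
  bound (B ∷ Bs) ms nzs w = subst (λ x → B ∷ Bs ≼ block x r ∷ [])
    (ℕ.*-cancelʳ-≡ (sumDegrees (B ∷ Bs)) d r (trans (ℕ.*-comm _ r)
      (trans (sym (totalWeight-multiplicity ms)) w)))
    (proj₂ (merge-all-≼ r B ms nzs))

∑-zero⊎ : {Q : Set} (xs : List A) {f : A → ℚ} → (∀ {x} → x ∈ xs → Q ⊎ f x ≡ 0ℚ) → Q ⊎ ∑ᵒ xs f ≡ 0ℚ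
∑-zero⊎ []       h = inj₂ refl
∑-zero⊎ (x ∷ xs) h with h (here refl) | ∑-zero⊎ xs (h ∘ there)
... | inj₁ q  | _       = inj₁ q
... | inj₂ _  | inj₁ q  = inj₁ q
... | inj₂ z  | inj₂ z′ = inj₂ (trans (cong₂ _⊕_ z z′) (⊕-identityˡ 0ℚ))

variables-one : ∀ {m} → All (All (_≡ 0)) m → variables m ≡ []
variables-one p = empty (variablesFrom-All {Q = λ _ → ⊥} (λ ()) 0 p)
  where
  empty : ∀ {Bs : List Block} → All (λ _ → ⊥) Bs → Bs ≡ []
  empty [] = refl

-- A nonzero coefficient requires a factorisation with both factors nonzero. Then `≼` leads from m
-- to its two factors by `variablesFrom-≼`, and from these to the blocks.
productOf-support : ∀ {Bs} → All HasDegree Bs → ∀ m →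
  variables m ≼ Bs ⊎ productOf (squareFreeAt 1ℚ) Bs m ≡ 0ℚ
productOf-support [] m with all? (all? (ℕ._≟ 0)) m
... | yes p = inj₁ (inj₂ (↭-reflexive (variables-one p)))
... | no  _ = inj₂ refl
productOf-support {block d r ∷ Bs} (nz ∷ nzs) m = ∑-zero⊎ (factorisations m) λ {(u , v)} uv∈ →
  combine u v (variablesFrom-≼ 0 (∈-factorisations⁻ {m} {u} {v} uv∈))
    (squareFree-support 1ℚ d r {{nz}} u) (productOf-support nzs v)
  where
  combine : ∀ u v → variables m ≼ variables u ++ variables v →
    variables u ≼ block d r ∷ [] ⊎ squareFree 1ℚ d r u ≡ 0ℚ →
    variables v ≼ Bs ⊎ productOf (squareFreeAt 1ℚ) Bs v ≡ 0ℚ →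
    variables m ≼ block d r ∷ Bs ⊎ squareFree 1ℚ d r u ⊗ productOf (squareFreeAt 1ℚ) Bs v ≡ 0ℚ
  combine u v p (inj₁ q) (inj₁ q′) = inj₁ (≼-trans p (++-mono-≼ q q′))
  combine u v p (inj₂ z) _         = inj₂ (trans (⊗-congʳ z) (⊗-zeroˡ _))
  combine u v p _        (inj₂ z)  = inj₂ (trans (⊗-congˡ z) (⊗-zeroʳ _))

-- Positivity of the diagonal coefficients

opaque
  unfolding _⊕_ _⊗_

  ⊕-nonNegative : ∀ {p q} → NonNegative p → NonNegative q → NonNegative (p ⊕ q)
  ⊕-nonNegative {p} {q} x y = ℚ.nonNeg+nonNeg⇒nonNeg p {{x}} q {{y}}

  ⊗-nonNegative : ∀ {p q} → NonNegative p → NonNegative q → NonNegative (p ⊗ q)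
  ⊗-nonNegative {p} {q} x y = ℚ.nonNeg*nonNeg⇒nonNeg p {{x}} q {{y}}

  ⊕-positiveˡ : ∀ {p q} → Positive p → NonNegative q → Positive (p ⊕ q)
  ⊕-positiveˡ {p} {q} x y = ℚ.pos+nonNeg⇒pos p {{x}} q {{y}}

  ⊕-positiveʳ : ∀ {p q} → NonNegative p → Positive q → Positive (p ⊕ q)
  ⊕-positiveʳ {p} {q} x y = ℚ.nonNeg+pos⇒pos p {{x}} q {{y}}

  ⊗-cancel-positive : ∀ {p q} → Positive q → p ⊗ q ≡ 0ℚ → p ≡ 0ℚ
  ⊗-cancel-positive {p} {q} pos eq = ℚ.≤-antisym
    (ℚ.*-cancelʳ-≤-pos q {{pos}} (ℚ.≤-reflexive pq≡0q))
    (ℚ.*-cancelʳ-≤-pos q {{pos}} (ℚ.≤-reflexive (sym pq≡0q)))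
    where
    pq≡0q : p * q ≡ 0ℚ * q
    pq≡0q = trans eq (sym (ℚ.*-zeroˡ q))

∑-nonNegative : (xs : List A) {f : A → ℚ} → (∀ x → NonNegative (f x)) → NonNegative (∑ᵒ xs f)
∑-nonNegative []       h = _
∑-nonNegative (x ∷ xs) h = ⊕-nonNegative (h x) (∑-nonNegative xs h)

∑-positive : {xs : List A} {f : A → ℚ} → (∀ x → NonNegative (f x)) → ∀ {x} → x ∈ xs → Positive (f x) → Positive (∑ᵒ xs f)
∑-positive {xs = _ ∷ xs} h (here refl) p = ⊕-positiveˡ p (∑-nonNegative xs h)
∑-positive {xs = x ∷ _}  h (there x∈)  p = ⊕-positiveʳ (h x) (∑-positive h x∈ p)

∏-nonNegative : {f : A → ℚ} → (∀ x → NonNegative (f x)) → ∀ xs → NonNegative (∏ f xs)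
∏-nonNegative h []       = _
∏-nonNegative h (x ∷ xs) = ⊗-nonNegative (h x) (∏-nonNegative h xs)

𝟙-nonNegative : ∀ b → NonNegative (𝟙 b)
𝟙-nonNegative false = _
𝟙-nonNegative true  = _

wt-nonNegative : ∀ r e → NonNegative (wt 1ℚ r e)
wt-nonNegative r zero    = _
wt-nonNegative r (suc e) = 𝟙-nonNegative (does (suc e ℕ.≟ r))

squareFreeAt-nonNegative : ∀ B m → NonNegative (squareFreeAt 1ℚ B m)
squareFreeAt-nonNegative (block d r) m = ⊗-nonNegative (𝟙-nonNegative (does (deg m ℕ.≟ d ℕ.* r)))
  (∏-nonNegative (∏-nonNegative (wt-nonNegative r)) m)

productOf-nonNegative : ∀ Bs m → NonNegative (productOf (squareFreeAt 1ℚ) Bs m)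
productOf-nonNegative []       m = 𝟙-nonNegative (does (all? (all? (ℕ._≟ 0)) m))
productOf-nonNegative (B ∷ Bs) m = ∑-nonNegative (factorisations m) λ (u , v) →
  ⊗-nonNegative (squareFreeAt-nonNegative B u) (productOf-nonNegative Bs v)

-- Factorisations keep the shape of a row, so the trivial factor has to be a row of zeros of
-- matching length.
rowZero : ∀ i es → ∃[ as ] Zip Sums es as es × Zip Sums es es as × rowVariables i as ≡ []
rowZero i []       = [] , [] , [] , refl
rowZero i (e ∷ es) with as , p , q , eq ← rowZero i es = 0 ∷ as , refl ∷ p , ℕ.+-identityʳ e ∷ q , eq

monomialZero : ∀ i m → ∃[ u ] Factors m u m × Factors m m u × variablesFrom i u ≡ []
monomialZero i []       = [] , [] , [] , refl
monomialZero i (es ∷ m) with as , p , q , eq ← rowZero i es | u , ps , qs , eqs ← monomialZero (suc i) m =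
  as ∷ u , p ∷ ps , q ∷ qs , trans (cong (_++ variablesFrom (suc i) u) eq) eqs

rowExtract : ∀ i es {B} → B ∈ rowVariables i es →
  ∃[ as ] ∃[ bs ] Zip Sums es as bs × rowVariables i as ≡ B ∷ [] × rowVariables i es ↭ B ∷ rowVariables i bs
rowExtract i (zero ∷ es)  B∈ with as , bs , p , eq , perm ← rowExtract i es B∈ =
  0 ∷ as , 0 ∷ bs , refl ∷ p , eq , perm
rowExtract i (suc e ∷ es) (here refl) with as , p , _ , eq ← rowZero i es =
  suc e ∷ as , 0 ∷ es , ℕ.+-identityʳ (suc e) ∷ p , cong (block (suc i) (suc e) ∷_) eq , ↭-refl
rowExtract i (suc e ∷ es) {B} (there B∈) with as , bs , p , eq , perm ← rowExtract i es B∈ =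
  0 ∷ as , suc e ∷ bs , refl ∷ p , eq , ↭-trans (↭-prep _ perm) (Perm.swap _ B ↭-refl)

monomialExtract : ∀ i m {B} → B ∈ variablesFrom i m →
  ∃[ u ] ∃[ v ] Factors m u v × variablesFrom i u ≡ B ∷ [] × variablesFrom i m ↭ B ∷ variablesFrom i v
monomialExtract i (es ∷ m) {B} B∈ with ∈-++⁻ (rowVariables i es) B∈
... | inj₁ j with as , bs , p , eq , perm ← rowExtract i es j | u , q , _ , eq′ ← monomialZero (suc i) m =
  as ∷ u , bs ∷ m , p ∷ q , cong₂ _++_ eq eq′ , Perm.++⁺ʳ _ perm
... | inj₂ j with u , v , p , eq , perm ← monomialExtract (suc i) m j | as , q , _ , eq′ ← rowZero i es =
  as ∷ u , es ∷ v , q ∷ p , cong₂ _++_ eq′ eq ,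
  ↭-trans (Perm.++⁺ˡ (rowVariables i es) perm) (Perm.shift B (rowVariables i es) _)

squareFree-variable : ∀ B {u} → variables u ≡ B ∷ [] → squareFreeAt 1ℚ B u ≡ 1ℚ
squareFree-variable (block d r) {u} eq = trans (cong₂ _⊗_
  (𝟙-yes (deg u ℕ.≟ d ℕ.* r) (trans (sym (variablesFrom-weight 0 u)) (trans (cong totalWeight eq)
    (trans (ℕ.+-identityʳ (r ℕ.* d)) (ℕ.*-comm r d)))))
  (∏≡1 (∏≡1 λ { (inj₁ refl) → refl ; (inj₂ refl) → wt-r r 1ℚ })
    (variablesFrom-All⁻ {P = λ e → e ≡ 0 ⊎ e ≡ r} {HasMultiplicity r} (inj₁ refl) inj₂ 0 u
      (subst (All (HasMultiplicity r)) (sym eq) (refl ∷ [])))))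
  (⊗-identityˡ 1ℚ)

-- No term is negative, so one positive term suffices. It comes from splitting off the variable that
-- represents `B`, which has coefficient 1, and recursing on the rest.
productOf-positive : ∀ Bs m → variables m ↭ Bs → Positive (productOf (squareFreeAt 1ℚ) Bs m)
productOf-positive [] m eq = subst Positive (sym (𝟙-yes (all? (all? (ℕ._≟ 0)) m)
  (variablesFrom-All⁻ {Q = λ _ → ⊥} refl (λ ()) 0 m (subst (All _) (sym (↭-empty-inv eq)) [])))) _
productOf-positive (B ∷ Bs) m eq
  with u , v , p , equ , perm ← monomialExtract 0 m (∈-resp-↭ (↭-sym eq) (here refl)) =
  ∑-positive (λ (u , v) → ⊗-nonNegative (squareFreeAt-nonNegative B u) (productOf-nonNegative Bs v))
    (∈-factorisations⁺ p)
    (subst Positive (sym (trans (⊗-congʳ (squareFree-variable B {u} equ)) (⊗-identityˡ _)))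
      (productOf-positive Bs v (drop-∷ (↭-trans (↭-sym perm) eq))))

-- The exponent is put in front of its row, so each block gets an indeterminate of its own and
-- blocks of equal degree stay apart.
insertVariable : ℕ → ℕ → Monomial → Monomial
insertVariable zero    e []       = (e ∷ []) ∷ []
insertVariable zero    e (es ∷ m) = (e ∷ es) ∷ m
insertVariable (suc j) e []       = [] ∷ insertVariable j e []
insertVariable (suc j) e (es ∷ m) = es ∷ insertVariable j e m

variables-insertVariable : ∀ i j e m →
  variablesFrom i (insertVariable j (suc e) m) ↭ block (suc (i ℕ.+ j)) (suc e) ∷ variablesFrom i m
variables-insertVariable i zero    e []       rewrite ℕ.+-identityʳ i = ↭-refl
variables-insertVariable i zero    e (es ∷ m) rewrite ℕ.+-identityʳ i = ↭-refl
variables-insertVariable i (suc j) e []       rewrite ℕ.+-suc i j     = variables-insertVariable (suc i) j e []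
variables-insertVariable i (suc j) e (es ∷ m) rewrite ℕ.+-suc i j     = ↭-trans
  (Perm.++⁺ˡ (rowVariables i es) (variables-insertVariable (suc i) j e m))
  (Perm.shift _ (rowVariables i es) _)

monomialOf : ∀ {Bs} → All HasDegree Bs → ∃[ m ] variables m ↭ Bs
monomialOf [] = [] , ↭-refl
monomialOf {block zero r ∷ _} (() ∷ _)
monomialOf {block (suc d) zero {{()}} ∷ _} _
monomialOf {block (suc d) (suc e) ∷ _} (_ ∷ nzs) with m , eq ← monomialOf nzs =
  insertVariable d (suc e) m , ↭-trans (variables-insertVariable 0 d e m) (↭-prep _ eq)

hasDegree-blocksFrom : ∀ {k} i (ps : Vec Partition k) → All HasDegree (blocksFrom i ps)
hasDegree-blocksFrom i []                         = []
hasDegree-blocksFrom i (mkPartition ds pos _ ∷ ps) =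
  All.++⁺ (All.map⁺ (recompute (all? ℕ.nonZero? ds) pos)) (hasDegree-blocksFrom (suc i) ps)

hasDegree-blocks : ∀ {n} (τ : Typ n) → All HasDegree (blocks τ)
hasDegree-blocks τ = hasDegree-blocksFrom 0 (factors τ)

∈⇒f≤sum : (f : A → ℕ) → ∀ {x xs} → x ∈ xs → f x ℕ.≤ sum (map f xs)
∈⇒f≤sum f {xs = _ ∷ xs} (here refl) = ℕ.m≤m+n _ _
∈⇒f≤sum f {xs = y ∷ _}  (there x∈)  = ℕ.≤-trans (∈⇒f≤sum f x∈) (ℕ.m≤n+m _ (f y))

-- Uniqueness of the expansion

module _ {n : ℕ} where

  typeRank : Typ n → ℕ
  typeRank τ = totalRank (blocks τ)

  -- Evaluating at the monomial of σ only leaves τ = σ and types τ of larger rank.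
  E⁺-independent : (U : List (Typ n)) → Unique U → (a : Typ n → ℚ) → (∀ τ → τ ∉ U → a τ ≡ 0ℚ) →
    (∀ m → ∑ᵒ U (λ τ → a τ ⊗ E⁺ τ m) ≡ 0ℚ) → ∀ τ → a τ ≡ 0ℚ
  E⁺-independent U unique a vanish sum≡0 τ = descend bound τ (ℕ.m≤n+m bound (typeRank τ))
    where
    bound = suc (sum (map typeRank U))
    -- Downward induction on rank: `bound` exceeds every rank in U, so at k = 0 the type lies
    -- outside U, and each passage to a larger rank uses up one unit of k.
    descend : ∀ k τ → bound ℕ.≤ typeRank τ ℕ.+ k → a τ ≡ 0ℚ
    descend zero σ le = vanish σ λ σ∈ → ℕ.<⇒≱ le
      (subst (ℕ._≤ _) (sym (ℕ.+-identityʳ (typeRank σ))) (∈⇒f≤sum typeRank σ∈))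
    descend (suc k) σ le with _∈?_ _≟ᵀ_ σ U
    ... | no  σ∉ = vanish σ σ∉
    ... | yes σ∈ with m , eq ← monomialOf (hasDegree-blocks σ) = ⊗-cancel-positive
      (subst Positive (sym (E⁺-productOf σ m)) (productOf-positive (blocks σ) m eq)) (begin
        a σ ⊗ E⁺ σ m
          ≡⟨ ∑-δ _≟ᵀ_ (λ τ → a τ ⊗ E⁺ τ m) unique σ∈ ⟨
        ∑ᵒ U (λ τ → 𝟙 (does (σ ≟ᵀ τ)) ⊗ (a τ ⊗ E⁺ τ m))
          ≡⟨ (∑-cong U λ τ → only τ (σ ≟ᵀ τ)) ⟩
        ∑ᵒ U (λ τ → a τ ⊗ E⁺ τ m)
          ≡⟨ sum≡0 m ⟩
        0ℚ ∎)
      where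
      other : ∀ τ → σ ≢ τ → a τ ⊗ E⁺ τ m ≡ 0ℚ
      other τ σ≢τ with productOf-support (hasDegree-blocks τ) m
      ... | inj₂ z = trans (⊗-congˡ (trans (E⁺-productOf τ m) z)) (⊗-zeroʳ (a τ))
      ... | inj₁ (inj₂ p) = contradiction (blocks-injective (↭-trans (↭-sym eq) p)) σ≢τ
      ... | inj₁ (inj₁ lt) = trans (⊗-congʳ (descend k τ (ℕ.≤-trans le (ℕ.≤-trans
        (ℕ.≤-reflexive (ℕ.+-suc (typeRank σ) k))
        (ℕ.+-monoˡ-≤ k (subst (ℕ._< typeRank τ) (totalRank-↭ eq) lt)))))) (⊗-zeroˡ _)
      only : ∀ τ → (σ≟τ : Dec (σ ≡ τ)) → 𝟙 (does σ≟τ) ⊗ (a τ ⊗ E⁺ τ m) ≡ a τ ⊗ E⁺ τ m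
      only τ (yes _)  = ⊗-identityˡ _
      only τ (no σ≢τ) = trans (⊗-zeroˡ _) (sym (other τ σ≢τ))

∑-support : (_≟_ : DecidableEquality A) (f : A → ℚ) → ∀ {xs ys} → Unique xs → Unique ys →
  (∀ {x} → x ∈ xs → x ∈ ys) → (∀ x → x ∉ xs → f x ≡ 0ℚ) → ∑ᵒ ys f ≡ ∑ᵒ xs f
∑-support _≟_ f {xs} {ys} uxs uys sub vanish = begin
  ∑ᵒ ys f
    ≡⟨ (∑-cong ys λ y → expand y (_∈?_ _≟_ y xs)) ⟩
  ∑ᵒ ys (λ y → ∑ᵒ xs λ x → 𝟙 (does (y ≟ x)) ⊗ f x)
    ≡⟨ ∑-swap ys xs _ ⟩
  ∑ᵒ xs (λ x → ∑ᵒ ys λ y → 𝟙 (does (y ≟ x)) ⊗ f x)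
    ≡⟨ ∑-cong∈ xs (λ {x} x∈ → trans
         (∑-cong ys λ y → ⊗-congʳ (cong 𝟙 (does-⇔ (mk⇔ sym sym) (y ≟ x) (x ≟ y))))
         (∑-δ _≟_ (λ _ → f x) uys (sub x∈))) ⟩
  ∑ᵒ xs f ∎
  where
  expand : ∀ y → Dec (y ∈ xs) → f y ≡ ∑ᵒ xs λ x → 𝟙 (does (y ≟ x)) ⊗ f x
  expand y (yes y∈) = sym (∑-δ _≟_ f uxs y∈)
  expand y (no  y∉) = trans (vanish y y∉) (sym (trans
    (∑-cong∈ xs λ {x} x∈ → trans (⊗-congʳ (𝟙-no (y ≟ x) λ { refl → y∉ x∈ })) (⊗-zeroˡ (f x)))
    (∑-zero xs)))

x⊕-1⊗y≡0⇒x≡y : ∀ {x y} → x ⊕ -1ℚ ⊗ y ≡ 0ℚ → x ≡ y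
x⊕-1⊗y≡0⇒x≡y {x} {y} eq = trans (x⊕y≡z⇒x≡-y⊕z eq) (trans (⊕-identityʳ _)
  (trans (sym (⊗-assoc -1ℚ -1ℚ y)) (trans (⊗-congʳ -1⊗-1) (⊗-identityˡ y))))
  where
  opaque
    unfolding _⊗_
    -1⊗-1 : -1ℚ ⊗ -1ℚ ≡ 1ℚ
    -1⊗-1 = refl

-- Over the union of both supports, the difference of the two coefficient functions is an expansion
-- of the zero series, to which `E⁺-independent` applies.
E⁺-expansion-unique : ∀ {n} {F : Series} {c c′ : Typ n → ℚ} →
  IsExpansion E⁺ F c → IsExpansion E⁺ F c′ → ∀ τ → c τ ≡ c′ τ
E⁺-expansion-unique {F = F} {c} {c′} e e′ τ = x⊕-1⊗y≡0⇒x≡y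
  (E⁺-independent U (deduplicate-! _≟ᵀ_ _) (λ τ → c τ ⊕ -1ℚ ⊗ c′ τ) vanish sum≡0′ τ)
  where
  open IsExpansion
  U = deduplicate _≟ᵀ_ (support e ++ support e′)
  vanish : ∀ τ → τ ∉ U → c τ ⊕ -1ℚ ⊗ c′ τ ≡ 0ℚ
  vanish τ τ∉ = trans (cong₂ (λ x y → x ⊕ -1ℚ ⊗ y)
    (vanishing e τ (τ∉ ∘ ∈-deduplicate⁺ _≟ᵀ_ ∘ ∈-++⁺ˡ))
    (vanishing e′ τ (τ∉ ∘ ∈-deduplicate⁺ _≟ᵀ_ ∘ ∈-++⁺ʳ (support e))))
    (trans (⊕-identityˡ _) (⊗-zeroʳ -1ℚ))
  extend : ∀ {c} (e : IsExpansion E⁺ F c) → (∀ {τ} → τ ∈ support e → τ ∈ U) → ∀ m →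
    ∑ᵒ U (λ τ → c τ ⊗ E⁺ τ m) ≡ F m
  extend {c} e sub m = trans
    (∑-support _≟ᵀ_ _ (distinct e) (deduplicate-! _≟ᵀ_ _) sub
      λ τ τ∉ → trans (⊗-congʳ (vanishing e τ τ∉)) (⊗-zeroˡ _))
    (sym (trans (expands e m) (∑-∑ᵒ (support e) c λ τ → E⁺ τ m)))
  sum≡0′ : ∀ m → ∑ᵒ U (λ τ → (c τ ⊕ -1ℚ ⊗ c′ τ) ⊗ E⁺ τ m) ≡ 0ℚ
  sum≡0′ m = begin
    ∑ᵒ U (λ τ → (c τ ⊕ -1ℚ ⊗ c′ τ) ⊗ E⁺ τ m)
      ≡⟨ (∑-cong U λ τ → trans (⊗-distribʳ-⊕ (E⁺ τ m) (c τ) _) (⊕-congˡ (⊗-assoc -1ℚ (c′ τ) _))) ⟩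
    ∑ᵒ U (λ τ → c τ ⊗ E⁺ τ m ⊕ -1ℚ ⊗ (c′ τ ⊗ E⁺ τ m))
      ≡⟨ ∑-⊕ U _ _ ⟩
    ∑ᵒ U (λ τ → c τ ⊗ E⁺ τ m) ⊕ ∑ᵒ U (λ τ → -1ℚ ⊗ (c′ τ ⊗ E⁺ τ m))
      ≡⟨ cong₂ _⊕_ (extend e (∈-deduplicate⁺ _≟ᵀ_ ∘ ∈-++⁺ˡ) m)
           (trans (sym (∑-⊗ˡ -1ℚ U _))
             (⊗-congˡ (extend e′ (∈-deduplicate⁺ _≟ᵀ_ ∘ ∈-++⁺ʳ (support e)) m))) ⟩
    F m ⊕ -1ℚ ⊗ F m
      ≡⟨ ⊕-congʳ (⊗-identityˡ (F m)) ⟨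
    1ℚ ⊗ F m ⊕ -1ℚ ⊗ F m
      ≡⟨ ⊗-distribʳ-⊕ (F m) 1ℚ -1ℚ ⟨
    (1ℚ ⊕ -1ℚ) ⊗ F m
      ≡⟨ trans (⊗-congʳ (⊕-inverseʳ 1ℚ)) (⊗-zeroˡ (F m)) ⟩
    0ℚ ∎

theorem50 : (n : ℕ) (σ τ : Typ n) →
    ∃[ N ] ((PTdyad σ τ ↔ Fin N) × IsCoefficient (E⁺ {n}) (E σ) τ (sign (ℓ τ) * (+ N / 1)))
theorem50 n σ τ = length (tilingsOfType σ τ) , PTdyad↔Fin σ τ ,
  coefficient σ , E-isExpansion σ , (λ c e → E⁺-expansion-unique e (E-isExpansion σ)) , refl
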